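{- There is a computable linear order $\mathcal{L}$ of order-type $\omega$ such that $\mathcal{L}$ is not computably isomorphic to the standard presentation $(\mathbb{N},<)$ of $\omega$, yet for every cohesive set $C\subseteq\mathbb{N}$ the cohesive power $\Pi_C\mathcal{L}$ has order-type $\omega+\zeta\eta$.
   Context: A set $C\subseteq\mathbb{N}$ is cohesive if it is infinite and for every c.e. set $W$, either $C\setminus W$ or $C\cap W$ is finite. Write $X\subseteq^* Y$ if $X\setminus Y$ is finite. For a computable linear order $\mathcal{L}=(L,\prec_{\mathcal{L}})$ (computable domain $L\subseteq\mathbb{N}$, computable order), the cohesive power $\Pi_C\mathcal{L}$ has as elements the classes $[\varphi]$ of partial computable $\varphi\colon\mathbb{N}\to L$ with $C\subseteq^*\mathrm{dom}(\varphi)$ under $\varphi=_C\psi$ iff $C\subseteq^*\{x:\varphi(x)\downarrow=\psi(x)\downarrow\}$, ordered by $[\varphi]\prec[\psi]$ iff $C\subseteq^*\{x:\varphi(x)\downarrow,\psi(x)\downarrow,\varphi(x)\prec_{\mathcal{L}}\psi(x)\}$. $\omega,\zeta,\eta$ are the order-types of $\mathbb{N},\mathbb{Z},\mathbb{Q}$; $\zeta\eta$ means $\eta$-many copies of $\zeta$ ordered lexicographically. -}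

module Defs where

open import Level using (0ℓ)
open import Data.Nat using (ℕ; zero; suc; _≤_; _<_)
open import Data.Fin using (Fin)
open import Data.Vec using (Vec; []; _∷_; lookup)
open import Data.Integer as ℤ using (ℤ)
open import Data.Rational as ℚ using (ℚ)
open import Data.Product using (Σ; ∃; _×_; _,_)
open import Data.Sum using (_⊎_)
open import Relation.Nullary using (¬_)
open import Relation.Binary.PropositionalEquality using (_≡_)
open import Function.Bundles using (_⇔_)

-- A model of computation: codes of (partial) μ-recursive functions
-- with a big-step evaluation relation.  A partial function ℕ^n ⇀ ℕ is
-- (partial) computable iff it is the semantics of some `Code n`.

data Code : ℕ → Set where
  zer  : ∀ {n} → Code n
  succ : Code 1
  proj : ∀ {n} → Fin n → Code n
  comp : ∀ {m n} → Code m → Vec (Code n) m → Code n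
  prec : ∀ {n} → Code n → Code (suc (suc n)) → Code (suc n)
  mu   : ∀ {n} → Code (suc n) → Code n

mutual
  data Eval : ∀ {n} → Code n → Vec ℕ n → ℕ → Set where
    zer⇓  : ∀ {n} {xs : Vec ℕ n} → Eval zer xs 0
    succ⇓ : ∀ {x} → Eval succ (x ∷ []) (suc x)
    proj⇓ : ∀ {n} (i : Fin n) {xs : Vec ℕ n} → Eval (proj i) xs (lookup xs i)
    comp⇓ : ∀ {m n} {f : Code m} {gs : Vec (Code n) m} {xs : Vec ℕ n}
              {ys : Vec ℕ m} {y : ℕ} →
            EvalVec gs xs ys → Eval f ys y → Eval (comp f gs) xs y
    prec0⇓ : ∀ {n} {f : Code n} {g : Code (suc (suc n))} {xs : Vec ℕ n} {y} →
             Eval f xs y → Eval (prec f g) (0 ∷ xs) y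
    precS⇓ : ∀ {n} {f : Code n} {g : Code (suc (suc n))} {xs : Vec ℕ n} {k r y} →
             Eval (prec f g) (k ∷ xs) r → Eval g (k ∷ r ∷ xs) y →
             Eval (prec f g) (suc k ∷ xs) y
    mu⇓   : ∀ {n} {f : Code (suc n)} {xs : Vec ℕ n} {y} →
            Eval f (y ∷ xs) 0 →
            (∀ z → z < y → Σ ℕ (λ v → Eval f (z ∷ xs) (suc v))) →
            Eval (mu f) xs y

  data EvalVec : ∀ {m n} → Vec (Code n) m → Vec ℕ n → Vec ℕ m → Set where
    []  : ∀ {n} {xs : Vec ℕ n} → EvalVec [] xs []
    _∷_ : ∀ {m n} {g : Code n} {gs : Vec (Code n) m} {xs : Vec ℕ n} {y ys} →
          Eval g xs y → EvalVec gs xs ys → EvalVec (g ∷ gs) xs (y ∷ ys)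

_⟨_⟩⇓_ : Code 1 → ℕ → ℕ → Set
e ⟨ x ⟩⇓ y = Eval e (x ∷ []) y

-- domain of φ_e; the c.e. sets are exactly the sets W e
W : Code 1 → ℕ → Set
W e x = ∃ λ y → e ⟨ x ⟩⇓ y

Pred : Set₁
Pred = ℕ → Set

_⊆*_ : Pred → Pred → Set
X ⊆* Y = ∃ λ N → ∀ x → N ≤ x → X x → Y x

Finite : Pred → Set
Finite X = ∃ λ N → ∀ x → N ≤ x → ¬ X x

Infinite : Pred → Set
Infinite X = ∀ N → ∃ λ x → N ≤ x × X x

Cohesive : Pred → Set
Cohesive C = Infinite C ×
  (∀ (e : Code 1) → Finite (λ x → C x × ¬ W e x) ⊎ Finite (λ x → C x × W e x))

record ComputableLinearOrder : Set where
  field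
    dom      : Code 1
    ord      : Code 2
    dom-tot  : ∀ x → dom ⟨ x ⟩⇓ 0 ⊎ dom ⟨ x ⟩⇓ 1
    ord-tot  : ∀ x y → Eval ord (x ∷ y ∷ []) 0 ⊎ Eval ord (x ∷ y ∷ []) 1

  L : Pred
  L x = dom ⟨ x ⟩⇓ 1

  _≺_ : ℕ → ℕ → Set
  x ≺ y = Eval ord (x ∷ y ∷ []) 1

  field
    irrefl : ∀ x → L x → ¬ (x ≺ x)
    trans  : ∀ x y z → L x → L y → L z → x ≺ y → y ≺ z → x ≺ z
    linear : ∀ x y → L x → L y → x ≺ y ⊎ x ≡ y ⊎ y ≺ x

module _ (𝓛 : ComputableLinearOrder) where
  open ComputableLinearOrder 𝓛

  IsIsoToℕ : (ℕ → ℕ) → Set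
  IsIsoToℕ f = (∀ x y → L x → L y → (x ≺ y ⇔ f x < f y))
             × (∀ n → ∃ λ x → L x × f x ≡ n)

  HasTypeω : Set
  HasTypeω = ∃ λ (f : ℕ → ℕ) → IsIsoToℕ f

  ComputablyIsoℕ : Set
  ComputablyIsoℕ = Σ (Code 1) λ e → Σ (ℕ → ℕ) λ f →
    (∀ x → L x → e ⟨ x ⟩⇓ f x) × IsIsoToℕ f

  -- Cohesive power Π_C 𝓛, as a set of representatives with the
  -- equivalence =_C and order ≺_C.
  module CohesivePower (C : Pred) where

    Elem : Set
    Elem = Σ (Code 1) λ e → (C ⊆* W e) × (∀ x y → e ⟨ x ⟩⇓ y → L y)

    _=C_ : Elem → Elem → Set
    (φ , _) =C (ψ , _) = C ⊆* (λ x → ∃ λ y → φ ⟨ x ⟩⇓ y × ψ ⟨ x ⟩⇓ y)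

    _≺C_ : Elem → Elem → Set
    (φ , _) ≺C (ψ , _) =
      C ⊆* (λ x → ∃ λ a → ∃ λ b → φ ⟨ x ⟩⇓ a × ψ ⟨ x ⟩⇓ b × a ≺ b)

-- The order type ω + ζη : carrier ℕ ⊎ (ℤ × ℚ); all of ℕ first, then
-- η (= ℚ) many copies of ζ (= ℤ), ordered lexicographically (ℚ-coordinate
-- first, then ℤ-coordinate within a copy).

OmegaZetaEta : Set
OmegaZetaEta = ℕ ⊎ (ℤ × ℚ)

data _<ωζη_ : OmegaZetaEta → OmegaZetaEta → Set where
  ω<ω   : ∀ {m n} → m < n → Data.Sum.inj₁ m <ωζη Data.Sum.inj₁ n
  ω<ζη  : ∀ {m} {p} → Data.Sum.inj₁ m <ωζη Data.Sum.inj₂ p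
  copy< : ∀ {a b : ℤ} {q r : ℚ} → q ℚ.< r →
          Data.Sum.inj₂ (a , q) <ωζη Data.Sum.inj₂ (b , r)
  same< : ∀ {a b : ℤ} {q : ℚ} → a ℤ.< b →
          Data.Sum.inj₂ (a , q) <ωζη Data.Sum.inj₂ (b , q)

HasTypeωζη : ComputableLinearOrder → Pred → Set
HasTypeωζη 𝓛 C = Σ (Elem → OmegaZetaEta) λ F →
    (∀ a b → a =C b → F a ≡ F b)
  × (∀ a b → F a ≡ F b → a =C b)
  × (∀ a b → (a ≺C b ⇔ F a <ωζη F b))
  × (∀ t → ∃ λ a → F a ≡ t)
  where open CohesivePower 𝓛 C

{-# OPTIONS --safe #-}
module Submission where

open import Defs
open import Level using (0ℓ)
open import Axiom.ExcludedMiddle using (ExcludedMiddle)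
open import Data.Nat as ℕ hiding (compare)
open import Data.Nat.Properties as ℕ
open import Data.Fin using (Fin; zero; suc; toℕ)
open import Data.Integer as ℤ using (ℤ; _⊖_)
import Data.Integer.Properties as ℤ
open import Data.List using (List; []; _∷_; map; filter)
open import Data.List.Membership.Propositional using (_∈_)
open import Data.List.Membership.Propositional.Properties
  using (∈-map⁺; ∈-map⁻; ∈-filter⁺; ∈-filter⁻)
open import Data.List.Relation.Unary.All as All using (All; []; _∷_)
open import Data.List.Relation.Unary.Any using (here; there)
open import Data.Product using (Σ; ∃; _×_; _,_; proj₁; proj₂)
open import Data.Rational as ℚ using (ℚ)
import Data.Rational.Properties as ℚ
open import Data.Sum as Sum using (_⊎_; inj₁; inj₂)
open import Data.Vec as Vec using (Vec; []; _∷_; lookup)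
open import Data.Vec.Properties using (map-lookup-allFin)
open import Function.Bundles using (_⇔_; mk⇔; Equivalence)
open import Function.Construct.Symmetry using (⇔-sym)
open import Relation.Binary.Construct.Closure.ReflexiveTransitive using (Star; ε; _◅_; _◅◅_)
open import Relation.Binary.Definitions using (tri<; tri≈; tri>)
open import Relation.Binary.PropositionalEquality
open import Relation.Nullary using (¬_; yes; no; contradiction)
open import Relation.Nullary.Decidable using (decidable-stable)

open Equivalence using (to; from)

-- Let K be an undecidable c.e. set and R = {2a} ∪ {2a + 1 : a ∈ K} ⊆ ℕ.  The
-- presentation 𝓛 is (R , <) with its points renamed so that the domain becomes
-- decidable.  An isomorphism f with ℕ decides K, because a ∈ K iff
-- f(2a + 2) − f(2a) > 1.  In a cohesive power, however, each question "is
-- φ(x) + 1 ∈ R?" has the same answer for almost all x ∈ C, and every number is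
-- in R or has its successor in R.  So up to an error of 1 all computable
-- operations on ℕ act on the cohesive power: every element has an immediate
-- successor φ + 1 or φ + 2, every non-least one an immediate predecessor, and
-- the averages φ + ⌊(ψ − φ)/2⌋ separate elements that are not finitely far
-- apart.  The blocks of finitely distant elements beyond the first thus form a
-- countable dense order without endpoints, and each of them is a copy of ℤ.

-- Total computable functions

-- K is the diagonal set of all a such that program a, run on input a, halts with output 0. The
-- renaming that makes the domain decidable attaches the halting stage to the name of the point at
-- 2a + 1. The order type stays the same only if each such point gets exactly one name, hence a
-- machine that is in its halted state at one stage only. R is c.e. but undecidable, so no algorithm
-- can round arbitrary numbers into R. In a cohesive power none is required: "φ(x) ∈ R" is a c.e.
-- condition on x, so its answer is constant on almost all of C, and this answer selects,
-- non-uniformly, the one algorithm (with or without a correction by 1) that is right almost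
-- everywhere. Since all even numbers are in R, a correction by 1 always suffices, and finite
-- distance comes out the same whether it is counted in successors or in positions. Countability of
-- the power comes from Gödel numbers. There are no quotients: orders live on representatives, and
-- both =_C and "in the same block" appear as incomparability in a strict weak order.

record Computable {n} (f : Vec ℕ n → ℕ) : Set where
  constructor computable
  field
    code  : Code n
    code⇓ : ∀ xs → Eval code xs (f xs)

open Computable public

Computable₁ : (ℕ → ℕ) → Set
Computable₁ f = Computable {1} λ xs → f (lookup xs zero)

Computable₂ : (ℕ → ℕ → ℕ) → Set
Computable₂ f = Computable {2} λ xs → f (lookup xs zero) (lookup xs (suc zero))

private variable
  n : ℕ
  f g h : Vec ℕ n → ℕ

ext : (∀ xs → f xs ≡ g xs) → Computable f → Computable g
ext f≗g (computable c c⇓) =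
  computable c λ xs → subst (Eval c xs) (f≗g xs) (c⇓ xs)

var : (i : Fin n) → Computable λ xs → lookup xs i
var i = computable (proj i) λ _ → proj⇓ i

v0 : Computable {suc n} λ xs → lookup xs zero
v0 = var zero

v1 : Computable {suc (suc n)} λ xs → lookup xs (suc zero)
v1 = var (suc zero)

app₁ : {F : ℕ → ℕ} → Computable₁ F → Computable f → Computable λ xs → F (f xs)
app₁ {f = f} (computable c c⇓) (computable d d⇓) =
  computable (comp c (d ∷ [])) λ xs → comp⇓ (d⇓ xs ∷ []) (c⇓ (f xs ∷ []))

app₂ : {F : ℕ → ℕ → ℕ} → Computable₂ F → Computable f → Computable g →
       Computable λ xs → F (f xs) (g xs)
app₂ {f = f} {g = g} (computable c c⇓) (computable d d⇓) (computable e e⇓) =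
  computable (comp c (d ∷ e ∷ []))
    λ xs → comp⇓ (d⇓ xs ∷ e⇓ xs ∷ []) (c⇓ (f xs ∷ g xs ∷ []))

suc-c : Computable f → Computable λ xs → suc (f xs)
suc-c = app₁ {F = suc} (computable succ λ { (_ ∷ []) → succ⇓ })

const-c : ∀ k → Computable {n} λ _ → k
const-c zero    = computable zer λ _ → zer⇓
const-c (suc k) = suc-c (const-c k)

natrec : ℕ → (ℕ → ℕ → ℕ) → ℕ → ℕ
natrec z s zero    = z
natrec z s (suc k) = s k (natrec z s k)

projections⇓ : ∀ {m} (is : Vec (Fin n) m) (xs : Vec ℕ n) →
               EvalVec (Vec.map proj is) xs (Vec.map (lookup xs) is)
projections⇓ []       xs = []
projections⇓ (i ∷ is) xs = proj⇓ i ∷ projections⇓ is xs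

variables : ∀ n → Vec (Code n) n
variables n = Vec.map proj (Vec.allFin n)

variables⇓ : (xs : Vec ℕ n) → EvalVec (variables n) xs xs
variables⇓ xs = subst (EvalVec _ xs) (map-lookup-allFin xs)
                      (projections⇓ (Vec.allFin _) xs)

-- `prec` recurses on its first argument and passes the others along, so the bound is prepended to
-- the identity tuple of projections.
rec-c : {s : Vec ℕ (suc (suc n)) → ℕ} →
        Computable f → Computable s → Computable g →
        Computable λ xs → natrec (f xs) (λ k r → s (k ∷ r ∷ xs)) (g xs)
rec-c {n} {f} {g} {s} (computable c c⇓) (computable d d⇓) (computable e e⇓) =
  computable (comp (prec c d) (e ∷ variables n))
    λ xs → comp⇓ (e⇓ xs ∷ variables⇓ xs) (loop xs (g xs))
  where
  loop : ∀ xs k → Eval (prec c d) (k ∷ xs) (natrec (f xs) (λ k r → s (k ∷ r ∷ xs)) k)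
  loop xs zero    = prec0⇓ (c⇓ xs)
  loop xs (suc k) = precS⇓ (loop xs k) (d⇓ _)

if0 : ℕ → ℕ → ℕ → ℕ
if0 zero    a b = a
if0 (suc _) a b = b

app₃ : {F : ℕ → ℕ → ℕ → ℕ} →
       Computable {3} (λ xs → F (lookup xs zero) (lookup xs (suc zero)) (lookup xs (suc (suc zero)))) →
       Computable f → Computable g → Computable h →
       Computable λ xs → F (f xs) (g xs) (h xs)
app₃ {f = f} {g = g} {h = h} (computable c c⇓) (computable d d⇓) (computable e e⇓) (computable k k⇓) =
  computable (comp c (d ∷ e ∷ k ∷ []))
    λ xs → comp⇓ (d⇓ xs ∷ e⇓ xs ∷ k⇓ xs ∷ []) (c⇓ (f xs ∷ g xs ∷ h xs ∷ []))

if0-c : Computable f → Computable g → Computable h →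
        Computable λ xs → if0 (f xs) (g xs) (h xs)
if0-c = app₃ {F = if0}
  (ext (λ { (zero ∷ _ ∷ _ ∷ []) → refl ; (suc _ ∷ _ ∷ _ ∷ []) → refl })
       (rec-c v1 (var (suc (suc (suc (suc zero))))) v0))

pred-c : Computable f → Computable λ xs → pred (f xs)
pred-c = app₁ {F = pred}
  (ext (λ { (zero ∷ []) → refl ; (suc _ ∷ []) → refl }) (rec-c (const-c 0) v0 v0))

infixl 6 _+c_ _∸c_

_+c_ : Computable f → Computable g → Computable λ xs → f xs + g xs
_+c_ = app₂ {F = _+_} (ext (λ { (a ∷ b ∷ []) → natrec-+ a b }) (rec-c v1 (suc-c v1) v0))
  where
  natrec-+ : ∀ a b → natrec b (λ _ r → suc r) a ≡ a + b
  natrec-+ zero    b = refl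
  natrec-+ (suc a) b = cong suc (natrec-+ a b)

_∸c_ : Computable f → Computable g → Computable λ xs → f xs ∸ g xs
_∸c_ = app₂ {F = _∸_} (ext (λ { (a ∷ b ∷ []) → natrec-∸ a b }) (rec-c v0 (pred-c v1) v1))
  where
  natrec-∸ : ∀ a b → natrec a (λ _ r → pred r) b ≡ a ∸ b
  natrec-∸ a zero    = refl
  natrec-∸ a (suc b) = trans (cong pred (natrec-∸ a b)) (pred[m∸n]≡m∸[1+n] a b)

dist : ℕ → ℕ → ℕ
dist a b = (a ∸ b) + (b ∸ a)

dist-c : Computable f → Computable g → Computable λ xs → dist (f xs) (g xs)
dist-c a b = (a ∸c b) +c (b ∸c a)

dist-refl : ∀ a → dist a a ≡ 0
dist-refl a = cong₂ _+_ (n∸n≡0 a) (n∸n≡0 a)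

dist≡0⇒≡ : ∀ a b → dist a b ≡ 0 → a ≡ b
dist≡0⇒≡ a b eq = ≤-antisym
  (m∸n≡0⇒m≤n (m+n≡0⇒m≡0 (a ∸ b) eq)) (m∸n≡0⇒m≤n (m+n≡0⇒n≡0 (a ∸ b) eq))

-- Since ⌊a/2⌋ + ⌈a/2⌉ = a and ⌈a/2⌉ = ⌊(a+1)/2⌋, halving obeys the recursion h(a+1) = a - h(a).
half-c : Computable f → Computable λ xs → ⌊ f xs /2⌋
half-c = app₁ {F = ⌊_/2⌋} (ext (λ { (a ∷ []) → natrec-half a }) (rec-c (const-c 0) (v0 ∸c v1) v0))
  where
  natrec-half : ∀ a → natrec 0 _∸_ a ≡ ⌊ a /2⌋
  natrec-half zero    = refl
  natrec-half (suc a) = begin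
    a ∸ natrec 0 _∸_ a            ≡⟨ cong (a ∸_) (natrec-half a) ⟩
    a ∸ ⌊ a /2⌋                   ≡⟨ cong (_∸ ⌊ a /2⌋) (sym (⌊n/2⌋+⌈n/2⌉≡n a)) ⟩
    ⌊ a /2⌋ + ⌈ a /2⌉ ∸ ⌊ a /2⌋   ≡⟨ m+n∸m≡n ⌊ a /2⌋ ⌈ a /2⌉ ⟩
    ⌈ a /2⌉                       ∎
    where open ≡-Reasoning

-- Triangular numbers and the pairing function

triangle : ℕ → ℕ
triangle zero    = zero
triangle (suc k) = suc (k + triangle k)

triangle-c : Computable f → Computable λ xs → triangle (f xs)
triangle-c = app₁ {F = triangle}
  (ext (λ { (a ∷ []) → natrec-triangle a }) (rec-c (const-c 0) (suc-c (v0 +c v1)) v0))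
  where
  natrec-triangle : ∀ a → natrec 0 (λ k r → suc (k + r)) a ≡ triangle a
  natrec-triangle zero    = refl
  natrec-triangle (suc a) = cong (λ r → suc (a + r)) (natrec-triangle a)

triangle-mono : ∀ {m n} → m ≤ n → triangle m ≤ triangle n
triangle-mono z≤n       = z≤n
triangle-mono (s≤s m≤n) = s≤s (+-mono-≤ m≤n (triangle-mono m≤n))

triangle-cancel-< : ∀ {m n} → triangle m < triangle n → m < n
triangle-cancel-< p = ≰⇒> λ n≤m → <⇒≱ p (triangle-mono n≤m)

-- The largest d with `triangle d` ≤ k. Passing from k to k + 1 crosses at most one triangular
-- number, so a single test per step keeps it up to date.
diagonal : ℕ → ℕ
diagonal = natrec 0 λ k r → if0 (triangle (suc r) ∸ suc k) (suc r) r

diagonal-bounds : ∀ k → triangle (diagonal k) ≤ k × k < triangle (suc (diagonal k))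
diagonal-bounds zero    = z≤n , s≤s z≤n
diagonal-bounds (suc k) with diagonal-bounds k
... | lower , upper
  with triangle (suc (diagonal k)) ∸ suc k in eq
... | zero  = m∸n≡0⇒m≤n eq , s≤s (≤-trans upper (m≤n+m (triangle (suc (diagonal k))) (suc (diagonal k))))
... | suc _ = m≤n⇒m≤1+n lower , m∸n≢0⇒n<m λ eq0 → contradiction (trans (sym eq) eq0) λ ()

-- Cantor's pairing, enumerating the diagonals x + y = 0, 1, 2, …
opaque
  pair : ℕ → ℕ → ℕ
  pair a b = b + triangle (a + b)

  snd : ℕ → ℕ
  snd z = z ∸ triangle (diagonal z)

  fst : ℕ → ℕ
  fst z = diagonal z ∸ snd z

  pair-c : Computable f → Computable g → Computable λ xs → pair (f xs) (g xs)
  pair-c a b = b +c triangle-c (a +c b)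

  private
    diagonal-c : Computable f → Computable λ xs → diagonal (f xs)
    diagonal-c = app₁ {F = diagonal}
      (rec-c (const-c 0) (if0-c (triangle-c (suc-c v1) ∸c suc-c v0) (suc-c v1) v1) v0)

    -- As b ≤ a + b, the code lies between `triangle (a + b)` and `triangle (suc (a + b))`, and
    -- these intervals are disjoint for different sums.
    diagonal-pair : ∀ a b → diagonal (pair a b) ≡ a + b
    diagonal-pair a b = ≤-antisym
      (s≤s⁻¹ (triangle-cancel-< (≤-<-trans (proj₁ (diagonal-bounds (pair a b)))
        (s≤s (+-monoˡ-≤ (triangle (a + b)) (m≤n+m b a))))))
      (s≤s⁻¹ (triangle-cancel-< (≤-<-trans (m≤n+m (triangle (a + b)) b)
        (proj₂ (diagonal-bounds (pair a b))))))

    snd≤diagonal : ∀ z → snd z ≤ diagonal z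
    snd≤diagonal z = m≤n+o⇒m∸n≤o z (triangle (diagonal z))
      (≤-trans (s≤s⁻¹ (proj₂ (diagonal-bounds z))) (≤-reflexive (+-comm (diagonal z) _)))

  snd-c : Computable f → Computable λ xs → snd (f xs)
  snd-c a = a ∸c triangle-c (diagonal-c a)

  fst-c : Computable f → Computable λ xs → fst (f xs)
  fst-c a = diagonal-c a ∸c snd-c a

  snd-pair : ∀ a b → snd (pair a b) ≡ b
  snd-pair a b = trans (cong (λ d → pair a b ∸ triangle d) (diagonal-pair a b))
                       (m+n∸n≡m b (triangle (a + b)))

  fst-pair : ∀ a b → fst (pair a b) ≡ a
  fst-pair a b = trans (cong₂ _∸_ (diagonal-pair a b) (snd-pair a b)) (m+n∸n≡m a b)

  pair-fst-snd : ∀ z → pair (fst z) (snd z) ≡ z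
  pair-fst-snd z = trans
    (cong (λ d → snd z + triangle d) (m∸n+n≡m (snd≤diagonal z)))
    (m∸n+n≡m (proj₁ (diagonal-bounds z)))

-- A universal machine

-- A stack machine for Code.  A state consists of the program to be run, its
-- input and a stack of programs awaiting the result; a program is a tag with an
-- argument.  Tag 0 pops the stack, tags 1 to 5, 8 and 10 run codes, tags 6, 7,
-- 9 and 11 are pending computations, tag 12 marks a halted machine, and tag 13
-- is the state after halting, so that the machine is halted at one stage only.
state : ℕ → ℕ → ℕ → ℕ
state p x K = pair p (pair x K)

return : ℕ → ℕ → ℕ
return v K = state (pair 0 0) v K

dead : ℕ
dead = state (pair 13 0) 0 0

dispatch : ℕ → ℕ → ℕ → ℕ → ℕ
dispatch 0  a x K = state (fst K) x (snd K)
dispatch 1  a x K = return 0 K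
dispatch 2  a x K = return (suc (fst x)) K
dispatch 3  a x K = if0 a (return (fst x) K) (state (pair 3 (pred a)) (snd x) K)
dispatch 4  a x K = state (snd a) x (pair (fst a) K)
dispatch 5  a x K = state (fst a) x (pair (pair 6 (pair (snd a) x)) K)
dispatch 6  a x K = state (fst a) (snd a) (pair (pair 7 x) K)
dispatch 7  a x K = return (pair a x) K
dispatch 8  a x K =
  if0 (fst x)
    (state (fst a) (snd x) K)
    (state (pair 8 a) (pair (pred (fst x)) (snd x))
           (pair (pair 9 (pair (snd a) (pair (pred (fst x)) (snd x)))) K))
dispatch 9  a x K = state (fst a) (pair (fst (snd a)) (pair x (snd (snd a)))) K
dispatch 10 a x K = state a (pair 0 x) (pair (pair 11 (pair a (pair 0 x))) K)
dispatch 11 a x K =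
  if0 x
    (return (fst (snd a)) K)
    (state (fst a) (pair (suc (fst (snd a))) (snd (snd a)))
           (pair (pair 11 (pair (fst a) (pair (suc (fst (snd a))) (snd (snd a))))) K))
-- Tags 12 and 13 both end here, so a halted machine is dead one step later and stays dead.
dispatch _  a x K = dead

dispatch-c : {t a x K : Vec ℕ n → ℕ} →
  Computable t → Computable a → Computable x → Computable K →
  Computable λ xs → dispatch (t xs) (a xs) (x xs) (K xs)
dispatch-c {t = t} {a} {x} {K} (computable ct t⇓) (computable ca a⇓) (computable cx x⇓) (computable cK K⇓) =
  computable (comp (code table) (ct ∷ ca ∷ cx ∷ cK ∷ []))
    λ xs → comp⇓ (t⇓ xs ∷ a⇓ xs ∷ x⇓ xs ∷ K⇓ xs ∷ []) (code⇓ table (t xs ∷ a xs ∷ x xs ∷ K xs ∷ []))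
  where
  D : Vec ℕ 4 → ℕ
  D (t ∷ a ∷ x ∷ K ∷ []) = dispatch t a x K

  state-c : {p x K : Vec ℕ 4 → ℕ} → Computable p → Computable x → Computable K →
            Computable λ xs → state (p xs) (x xs) (K xs)
  state-c p x K = pair-c p (pair-c x K)

  return-c : {x K : Vec ℕ 4 → ℕ} → Computable x → Computable K →
             Computable λ xs → return (x xs) (K xs)
  return-c = state-c (pair-c (const-c 0) (const-c 0))

  -- The test is t ≤ m; the enclosing tests have already excluded all tags below m, so it amounts to
  -- t = m.
  cases : ∀ {m} {e d : Vec ℕ 4 → ℕ} → Computable e → Computable d →
          Computable λ xs → if0 (lookup xs zero ∸ m) (e xs) (d xs)
  cases {m} = if0-c (v0 ∸c const-c m)

  A X S : Computable {4} _
  A = v1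
  X = var (suc (suc zero))
  S = var (suc (suc (suc zero)))

  table : Computable D
  table = ext
    (λ { (0 ∷ a ∷ x ∷ K ∷ []) → refl
       ; (1 ∷ a ∷ x ∷ K ∷ []) → refl
       ; (2 ∷ a ∷ x ∷ K ∷ []) → refl
       ; (3 ∷ a ∷ x ∷ K ∷ []) → refl
       ; (4 ∷ a ∷ x ∷ K ∷ []) → refl
       ; (5 ∷ a ∷ x ∷ K ∷ []) → refl
       ; (6 ∷ a ∷ x ∷ K ∷ []) → refl
       ; (7 ∷ a ∷ x ∷ K ∷ []) → refl
       ; (8 ∷ a ∷ x ∷ K ∷ []) → refl
       ; (9 ∷ a ∷ x ∷ K ∷ []) → refl
       ; (10 ∷ a ∷ x ∷ K ∷ []) → refl
       ; (11 ∷ a ∷ x ∷ K ∷ []) → refl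
       ; (suc (suc (suc (suc (suc (suc (suc (suc (suc (suc (suc (suc t))))))))))) ∷ a ∷ x ∷ K ∷ []) → refl
       })
    (cases {0} (state-c (fst-c S) X (snd-c S))
    (cases {1} (return-c (const-c 0) S)
    (cases {2} (return-c (suc-c (fst-c X)) S)
    (cases {3} (if0-c A (return-c (fst-c X) S) (state-c (pair-c (const-c 3) (pred-c A)) (snd-c X) S))
    (cases {4} (state-c (snd-c A) X (pair-c (fst-c A) S))
    (cases {5} (state-c (fst-c A) X (pair-c (pair-c (const-c 6) (pair-c (snd-c A) X)) S))
    (cases {6} (state-c (fst-c A) (snd-c A) (pair-c (pair-c (const-c 7) X) S))
    (cases {7} (return-c (pair-c A X) S)
    (cases {8} (if0-c (fst-c X) (state-c (fst-c A) (snd-c X) S)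
       (state-c (pair-c (const-c 8) A) (pair-c (pred-c (fst-c X)) (snd-c X))
                (pair-c (pair-c (const-c 9) (pair-c (snd-c A) (pair-c (pred-c (fst-c X)) (snd-c X)))) S)))
    (cases {9} (state-c (fst-c A) (pair-c (fst-c (snd-c A)) (pair-c X (snd-c (snd-c A)))) S)
    (cases {10} (state-c A (pair-c (const-c 0) X) (pair-c (pair-c (const-c 11) (pair-c A (pair-c (const-c 0) X))) S))
    (cases {11} (if0-c X (return-c (fst-c (snd-c A)) S)
       (state-c (fst-c A) (pair-c (suc-c (fst-c (snd-c A))) (snd-c (snd-c A)))
                (pair-c (pair-c (const-c 11) (pair-c (fst-c A) (pair-c (suc-c (fst-c (snd-c A))) (snd-c (snd-c A))))) S)))
    (state-c (pair-c (const-c 13) (const-c 0)) (const-c 0) (const-c 0))))))))))))))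

step : ℕ → ℕ
step z = dispatch (fst (fst z)) (snd (fst z)) (fst (snd z)) (snd (snd z))

step-state : ∀ t a x K → step (state (pair t a) x K) ≡ dispatch t a x K
step-state t a x K
  rewrite fst-pair (pair t a) (pair x K) | snd-pair (pair t a) (pair x K)
        | fst-pair t a | snd-pair t a | fst-pair x K | snd-pair x K = refl

step-c : Computable f → Computable λ xs → step (f xs)
step-c = app₁ {F = step}
  (dispatch-c (fst-c (fst-c v0)) (snd-c (fst-c v0)) (fst-c (snd-c v0)) (snd-c (snd-c v0)))

run : ℕ → ℕ → ℕ
run z = natrec z λ _ → step

run-c : Computable f → Computable g → Computable λ xs → run (f xs) (g xs)
run-c = app₂ {F = run} (rec-c v0 (step-c v1) v1)

_↠_ : ℕ → ℕ → Set
_↠_ = Star λ y z → step y ≡ z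

↠⇒run : ∀ {y z} → y ↠ z → ∃ λ s → run y s ≡ z
↠⇒run ε = 0 , refl
↠⇒run {y} (refl ◅ r) with ↠⇒run r
... | s , eq = suc s , trans (step-run y s) eq
  where
  step-run : ∀ y s → step (run y s) ≡ run (step y) s
  step-run y zero    = refl
  step-run y (suc s) = cong step (step-run y s)

mutual
  ⌜_⌝ : Code n → ℕ
  ⌜ zer ⌝       = pair 1 0
  ⌜ succ ⌝      = pair 2 0
  ⌜ proj i ⌝    = pair 3 (toℕ i)
  ⌜ comp f gs ⌝ = pair 4 (pair ⌜ f ⌝ ⌜ gs ⌝*)
  ⌜ prec f g ⌝  = pair 8 (pair ⌜ f ⌝ ⌜ g ⌝)
  ⌜ mu f ⌝      = pair 10 ⌜ f ⌝

  ⌜_⌝* : ∀ {m} → Vec (Code n) m → ℕ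
  ⌜ [] ⌝*     = pair 1 0
  ⌜ g ∷ gs ⌝* = pair 5 (pair ⌜ g ⌝ ⌜ gs ⌝*)

tuple : Vec ℕ n → ℕ
tuple []       = 0
tuple (x ∷ xs) = pair x (tuple xs)

by-step : ∀ {t a x K z} → dispatch t a x K ≡ z → state (pair t a) x K ↠ z
by-step eq = trans (step-state _ _ _ _) eq ◅ ε

pop-↠ : ∀ v p K → return v (pair p K) ↠ state p v K
pop-↠ v p K = by-step (cong₂ (λ p K → state p v K) (fst-pair p K) (snd-pair p K))

step-5 : ∀ g gs x K → dispatch 5 (pair g gs) x K ≡ state g x (pair (pair 6 (pair gs x)) K)
step-5 g gs x K rewrite fst-pair g gs | snd-pair g gs = refl

step-6 : ∀ gs x v K → dispatch 6 (pair gs x) v K ≡ state gs x (pair (pair 7 v) K)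
step-6 gs x v K rewrite fst-pair gs x | snd-pair gs x = refl

step-8 : ∀ f g k x K → dispatch 8 (pair f g) (pair k x) K ≡
  if0 k (state f x K)
        (state (pair 8 (pair f g)) (pair (pred k) x) (pair (pair 9 (pair g (pair (pred k) x))) K))
step-8 f g k x K
  rewrite fst-pair f g | snd-pair f g | fst-pair k x | snd-pair k x = refl

step-9 : ∀ g k x r K → dispatch 9 (pair g (pair k x)) r K ≡ state g (pair k (pair r x)) K
step-9 g k x r K
  rewrite fst-pair g (pair k x) | snd-pair g (pair k x) | fst-pair k x | snd-pair k x = refl

step-11 : ∀ f k x v K → dispatch 11 (pair f (pair k x)) v K ≡
  if0 v (return k K)
        (state f (pair (suc k) x) (pair (pair 11 (pair f (pair (suc k) x))) K))
step-11 f k x v K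
  rewrite fst-pair f (pair k x) | snd-pair f (pair k x) | fst-pair k x | snd-pair k x = refl

mutual
  -- Quantifying over the stack makes the induction work: a subcomputation runs with the pending
  -- frames of its callers underneath. K is defined by machine runs, so this direction carries the
  -- diagonal argument.
  simulate : ∀ {e : Code n} {xs y} → Eval e xs y → ∀ K → state ⌜ e ⌝ (tuple xs) K ↠ return y K
  simulate zer⇓ K = by-step refl
  simulate (succ⇓ {x}) K = by-step (cong (λ a → return (suc a) K) (fst-pair x 0))
  simulate (proj⇓ i {xs}) K = lookup-↠ i xs
    where
    lookup-↠ : ∀ {n} (i : Fin n) xs → state (pair 3 (toℕ i)) (tuple xs) K ↠ return (lookup xs i) K
    lookup-↠ zero    (x ∷ xs) = by-step (cong (λ a → return a K) (fst-pair x (tuple xs)))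
    lookup-↠ (suc i) (x ∷ xs) =
      by-step (cong (λ a → state (pair 3 (toℕ i)) a K) (snd-pair x (tuple xs))) ◅◅ lookup-↠ i xs
  simulate (comp⇓ {f = f} {gs = gs} {xs = xs} {ys = ys} gs⇓ f⇓) K =
    by-step (cong₂ (λ f gs → state gs (tuple xs) (pair f K))
      (fst-pair ⌜ f ⌝ ⌜ gs ⌝*) (snd-pair ⌜ f ⌝ ⌜ gs ⌝*))
    ◅◅ simulate* gs⇓ (pair ⌜ f ⌝ K)
    ◅◅ pop-↠ (tuple ys) ⌜ f ⌝ K
    ◅◅ simulate f⇓ K
  simulate (prec0⇓ {f = f} {g} {xs} f⇓) K =
    by-step (step-8 ⌜ f ⌝ ⌜ g ⌝ 0 (tuple xs) K) ◅◅ simulate f⇓ K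
  simulate (precS⇓ {f = f} {g} {xs} {k} {r} h⇓ g⇓) K =
    by-step (step-8 ⌜ f ⌝ ⌜ g ⌝ (suc k) (tuple xs) K)
    ◅◅ simulate h⇓ _
    ◅◅ pop-↠ r _ K
    ◅◅ by-step (step-9 ⌜ g ⌝ k (tuple xs) r K)
    ◅◅ simulate g⇓ K
  simulate (mu⇓ {f = f} {xs} {y} f⇓ below) K = by-step refl ◅◅ search y 0 (+-identityʳ y)
    where
    frame : ℕ → ℕ
    frame z = pair (pair 11 (pair ⌜ f ⌝ (pair z (tuple xs)))) K
    -- `d` counts the candidates below y that remain to be rejected.
    search : ∀ d z → d + z ≡ y → state ⌜ f ⌝ (pair z (tuple xs)) (frame z) ↠ return y K
    search zero    z refl =
      simulate f⇓ (frame z) ◅◅ pop-↠ 0 _ K ◅◅ by-step (step-11 ⌜ f ⌝ z (tuple xs) 0 K)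
    search (suc d) z eq with below z (subst (suc z ≤_) eq (s≤s (m≤n+m z d)))
    ... | v , p =
      simulate p (frame z) ◅◅ pop-↠ (suc v) _ K ◅◅ by-step (step-11 ⌜ f ⌝ z (tuple xs) (suc v) K)
      ◅◅ search d (suc z) (trans (+-suc d z) eq)

  simulate* : ∀ {m} {gs : Vec (Code n) m} {xs ys} → EvalVec gs xs ys →
              ∀ K → state ⌜ gs ⌝* (tuple xs) K ↠ return (tuple ys) K
  simulate* [] K = by-step refl
  simulate* (_∷_ {g = g} {gs} {xs} {y} {ys} g⇓ gs⇓) K =
    by-step (step-5 ⌜ g ⌝ ⌜ gs ⌝* (tuple xs) K)
    ◅◅ simulate g⇓ _
    ◅◅ pop-↠ y _ K
    ◅◅ by-step (step-6 ⌜ gs ⌝* (tuple xs) y K)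
    ◅◅ simulate* gs⇓ _
    ◅◅ pop-↠ (tuple ys) _ K
    ◅◅ by-step refl

Halted : ℕ → Set
Halted z = fst (fst z) ≡ 12

output : ℕ → ℕ
output z = fst (snd z)

-- The bottom frame has tag 12: popping it with the final result yields the halted state, with the
-- result in the input slot read by `output`.
start : ℕ → ℕ → ℕ
start p x = state p x (pair (pair 12 0) 0)

Eval⇒halts : ∀ {e : Code n} {xs y} → Eval e xs y →
  ∃ λ s → Halted (run (start ⌜ e ⌝ (tuple xs)) s) × output (run (start ⌜ e ⌝ (tuple xs)) s) ≡ y
Eval⇒halts {e = e} {xs} {y} e⇓ with ↠⇒run (simulate e⇓ (pair (pair 12 0) 0) ◅◅ pop-↠ y (pair 12 0) 0)
... | s , eq = s
    , trans (cong (λ z → fst (fst z)) eq) (trans (cong fst (fst-pair (pair 12 0) (pair y 0))) (fst-pair 12 0))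
    , trans (cong (λ z → fst (snd z)) eq) (trans (cong fst (snd-pair (pair 12 0) (pair y 0))) (fst-pair y 0))

step-halted : ∀ z → Halted z → step z ≡ dead
step-halted z h rewrite h = refl

step-dead : step dead ≡ dead
step-dead = step-state 13 0 0 0

dead-not-halted : ¬ Halted dead
dead-not-halted h with trans (sym h) (trans (cong fst (fst-pair (pair 13 0) (pair 0 0))) (fst-pair 13 0))
... | ()

run-halted : ∀ z s k → Halted (run z s) → run z (suc k + s) ≡ dead
run-halted z s zero    h = step-halted (run z s) h
run-halted z s (suc k) h = trans (cong step (run-halted z s k h)) step-dead

halted-once-< : ∀ z s t → Halted (run z s) → Halted (run z t) → ¬ s < t
halted-once-< z s t hs ht s<t = dead-not-halted (subst Halted
  (trans (cong (run z) (sym (trans (sym (+-suc (t ∸ suc s) s)) (m∸n+n≡m s<t))))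
         (run-halted z s (t ∸ suc s) hs)) ht)

halted-once : ∀ z s t → Halted (run z s) → Halted (run z t) → s ≡ t
halted-once z s t hs ht with <-cmp s t
... | tri< s<t _ _ = contradiction s<t (halted-once-< z s t hs ht)
... | tri≈ _ s≡t _ = s≡t
... | tri> _ _ t<s = contradiction t<s (halted-once-< z t s ht hs)

-- Both computations are runs from one start state, which is halted at one stage only. So a Gödel
-- number determines the partial function of its code; for d = e this is determinism of `Eval`.
⌜⌝-functional : ∀ {d e : Code n} {xs y z} → ⌜ d ⌝ ≡ ⌜ e ⌝ → Eval d xs y → Eval e xs z → y ≡ z
⌜⌝-functional {d = d} {e} {xs} d≡e d⇓ e⇓ with Eval⇒halts d⇓ | Eval⇒halts e⇓
... | s , hs , ys | t , ht , zt rewrite d≡e =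
  trans (sym ys) (trans (cong (λ s → output (run z₀ s)) (halted-once z₀ s t hs ht)) zt)
  where z₀ = start ⌜ e ⌝ (tuple xs)

⇓-functional : ∀ {e : Code n} {xs y z} → Eval e xs y → Eval e xs z → y ≡ z
⇓-functional = ⌜⌝-functional refl

-- An undecidable c.e. set

opaque
  -- haltsAt n s ≡ 0 says that program n, run on input n, halts with output 0
  -- exactly at stage s.
  haltsAt : ℕ → ℕ → ℕ
  haltsAt n s = dist (fst (fst (run (start n (pair n 0)) s))) 12 + output (run (start n (pair n 0)) s)

  haltsAt-c : Computable f → Computable g → Computable λ xs → haltsAt (f xs) (g xs)
  haltsAt-c = app₂ {F = haltsAt} (dist-c (fst-c (fst-c r)) (const-c 12) +c fst-c (snd-c r))
    where
    r : Computable {2} λ xs → run (start (lookup xs zero) (pair (lookup xs zero) 0)) (lookup xs (suc zero))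
    r = run-c (pair-c v0 (pair-c (pair-c v0 (const-c 0)) (pair-c (pair-c (const-c 12) (const-c 0)) (const-c 0)))) v1

  haltsAt-halted : ∀ n s → haltsAt n s ≡ 0 → Halted (run (start n (pair n 0)) s)
  haltsAt-halted n s eq = dist≡0⇒≡ _ 12 (m+n≡0⇒m≡0 _ eq)

  haltsAt-unique : ∀ n s t → haltsAt n s ≡ 0 → haltsAt n t ≡ 0 → s ≡ t
  haltsAt-unique n s t hs ht =
    halted-once (start n (pair n 0)) s t (haltsAt-halted n s hs) (haltsAt-halted n t ht)

  -- Run on its own number, `e` outputs 0 iff that number is in K, whereas a decision procedure of
  -- this form outputs 0 exactly off K. For this contradiction K asks for output 0 and not just for
  -- halting.
  undecidable : (e : Code 1) (d : ℕ → ℕ) → (∀ x → e ⟨ x ⟩⇓ d x) →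
    ¬ (∀ n → (d n ≡ 0 → ¬ ∃ λ s → haltsAt n s ≡ 0) × (d n ≢ 0 → ∃ λ s → haltsAt n s ≡ 0))
  undecidable e d e⇓ decides with Eval⇒halts (e⇓ ⌜ e ⌝) | d ⌜ e ⌝ ≟ 0
  ... | s , h , o | yes d≡0 = proj₁ (decides ⌜ e ⌝) d≡0
    (s , cong₂ _+_ (trans (cong (λ t → dist t 12) h) (dist-refl 12)) (trans o d≡0))
  ... | s , h , o | no d≢0 with proj₂ (decides ⌜ e ⌝) d≢0
  ... | t , ht = d≢0 (trans (sym o) (trans
    (cong (λ s → output (run (start ⌜ e ⌝ (pair ⌜ e ⌝ 0)) s)) (halted-once (start ⌜ e ⌝ (pair ⌜ e ⌝ 0)) s t h (haltsAt-halted ⌜ e ⌝ t ht)))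
    (m+n≡0⇒n≡0 (dist (fst (fst (run (start ⌜ e ⌝ (pair ⌜ e ⌝ 0)) t))) 12) ht)))

-- Cantor's theorem for strict weak orders

-- This form fits both uses: `≈` is equality of representatives in the cohesive power, and finite
-- distance in the order of blocks.
record StrictWeakOrder (A : Set) : Set₁ where
  infix 4 _≺_ _≼_ _≈_
  field
    _≺_     : A → A → Set
    irrefl  : ∀ {a} → ¬ a ≺ a
    ≺-trans : ∀ {a b c} → a ≺ b → b ≺ c → a ≺ c
    compare : ∀ {a b} → a ≺ b → ∀ c → a ≺ c ⊎ c ≺ b

  _≼_ _≈_ : A → A → Set
  a ≼ b = ¬ b ≺ a
  a ≈ b = a ≼ b × b ≼ a

  ≺⇒≼ : ∀ {a b} → a ≺ b → a ≼ b
  ≺⇒≼ a≺b b≺a = irrefl (≺-trans a≺b b≺a)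

  ≼-≺-trans : ∀ {a b c} → a ≼ b → b ≺ c → a ≺ c
  ≼-≺-trans {a} a≼b b≺c with compare b≺c a
  ... | inj₁ b≺a = contradiction b≺a a≼b
  ... | inj₂ a≺c = a≺c

  ≺-≼-trans : ∀ {a b c} → a ≺ b → b ≼ c → a ≺ c
  ≺-≼-trans {c = c} a≺b b≼c with compare a≺b c
  ... | inj₁ a≺c = a≺c
  ... | inj₂ c≺b = contradiction c≺b b≼c

  ≼-refl : ∀ {a} → a ≼ a
  ≼-refl = irrefl

  ≼-trans : ∀ {a b c} → a ≼ b → b ≼ c → a ≼ c
  ≼-trans a≼b b≼c c≺a = b≼c (≺-≼-trans c≺a a≼b)

  ≈-refl : ∀ {a} → a ≈ a
  ≈-refl = ≼-refl , ≼-refl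

  ≈-sym : ∀ {a b} → a ≈ b → b ≈ a
  ≈-sym (p , q) = q , p

  ≈-trans : ∀ {a b c} → a ≈ b → b ≈ c → a ≈ c
  ≈-trans (p , q) (r , s) = ≼-trans p r , ≼-trans s q

record Dense {A : Set} (O : StrictWeakOrder A) : Set where
  open StrictWeakOrder O
  field
    point   : A
    below   : ∀ a → ∃ λ b → b ≺ a
    above   : ∀ a → ∃ λ b → a ≺ b
    between : ∀ {a b} → a ≺ b → ∃ λ c → a ≺ c × c ≺ b

ℚ-order : StrictWeakOrder ℚ
ℚ-order = record
  { _≺_ = ℚ._<_ ; irrefl = ℚ.<-irrefl refl ; ≺-trans = ℚ.<-trans ; compare = compare }
  where
  compare : ∀ {p q} → p ℚ.< q → ∀ r → p ℚ.< r ⊎ r ℚ.< q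
  compare {p} p<q r with p ℚ.<? r
  ... | yes p<r = inj₁ p<r
  ... | no p≮r  = inj₂ (ℚ.≤-<-trans (ℚ.≮⇒≥ p≮r) p<q)

ℚ-dense : Dense ℚ-order
ℚ-dense = record
  { point   = ℚ.0ℚ
  ; below   = λ q → q ℚ.- ℚ.1ℚ , subst (q ℚ.- ℚ.1ℚ ℚ.<_) (ℚ.+-identityʳ q) (ℚ.+-monoʳ-< q (ℚ.negative⁻¹ (ℚ.- ℚ.1ℚ)))
  ; above   = λ q → q ℚ.+ ℚ.1ℚ , subst (ℚ._< q ℚ.+ ℚ.1ℚ) (ℚ.+-identityʳ q) (ℚ.+-monoʳ-< q (ℚ.positive⁻¹ ℚ.1ℚ))
  ; between = λ p<q → let r , p<r , r<q = ℚ.<-dense p<q in r , p<r , r<q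
  }

enumℚ : ℕ → ℚ
enumℚ n = sign (fst n) ℚ./ suc (snd (snd n))
  where
  sign : ℕ → ℤ.ℤ
  sign zero    = ℤ.+ fst (snd n)
  sign (suc _) = ℤ.-[1+ fst (snd n) ]

enumℚ-surjective : ∀ q → ∃ λ n → enumℚ n ≡ q
enumℚ-surjective q@(ℚ.mkℚ (ℤ.+ a) d _) = pair 0 (pair a d) , lemma
  where
  lemma : enumℚ (pair 0 (pair a d)) ≡ q
  lemma rewrite fst-pair 0 (pair a d) | snd-pair 0 (pair a d) | fst-pair a d | snd-pair a d = ℚ.↥p/↧p≡p q
enumℚ-surjective q@(ℚ.mkℚ ℤ.-[1+ a ] d _) = pair 1 (pair a d) , lemma
  where
  lemma : enumℚ (pair 1 (pair a d)) ≡ q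
  lemma rewrite fst-pair 1 (pair a d) | snd-pair 1 (pair a d) | fst-pair a d | snd-pair a d = ℚ.↥p/↧p≡p q

module Classical (lem : ExcludedMiddle 0ℓ) where

  module Interpolation {Y : Set} (O : StrictWeakOrder Y) (D : Dense O) where
    open StrictWeakOrder O
    open Dense D

    above-one : ∀ l us → All (l ≺_) us → ∃ λ y → l ≺ y × All (y ≺_) us
    above-one l []       []           = let y , l≺y = above l in y , l≺y , []
    above-one l (u ∷ us) (l≺u ∷ l≺us) with above-one l us l≺us
    ... | y , l≺y , y≺us with lem {P = y ≺ u}
    ...   | yes y≺u = y , l≺y , y≺u ∷ y≺us
    ...   | no u≼y  = let y′ , l≺y′ , y′≺u = between l≺u in
                      y′ , l≺y′ , y′≺u ∷ All.map (≺-trans (≺-≼-trans y′≺u u≼y)) y≺us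

    below-all : ∀ us → ∃ λ y → All (y ≺_) us
    below-all []       = point , []
    below-all (u ∷ us) with below-all us
    ... | y , y≺us with lem {P = y ≺ u}
    ...   | yes y≺u = y , y≺u ∷ y≺us
    ...   | no u≼y  = let y′ , y′≺u = below u in
                      y′ , y′≺u ∷ All.map (≺-trans (≺-≼-trans y′≺u u≼y)) y≺us

    -- Bounds are added one at a time. If the new lower bound l is not below the old y, a point just
    -- above l and still below `us` replaces y; it exceeds y and so keeps the older lower bounds.
    interpolate : ∀ ls us → All (λ l → All (l ≺_) us) ls →
                  ∃ λ y → All (_≺ y) ls × All (y ≺_) us
    interpolate []       us []             = let y , y≺us = below-all us in y , [] , y≺us
    interpolate (l ∷ ls) us (l≺us ∷ ls≺us) with interpolate ls us ls≺us
    ... | y , ls≺y , y≺us with lem {P = l ≺ y}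
    ...   | yes l≺y = y , l≺y ∷ ls≺y , y≺us
    ...   | no y≼l  = let y′ , l≺y′ , y′≺us = above-one l us l≺us in
                      y′ , l≺y′ ∷ All.map (λ m≺y → ≺-trans m≺y (≼-≺-trans y≼l l≺y′)) ls≺y , y′≺us

  module _ {X Y : Set} (OX : StrictWeakOrder X) (OY : StrictWeakOrder Y) (DY : Dense OY) where
    private
      module X = StrictWeakOrder OX
      module Y = StrictWeakOrder OY

    -- A point equivalent to an old one receives the old image; any other is comparable with all old
    -- points, and density of the target fills the cut. The finite map is given by two functions on
    -- `P`, so exchanging them turns the forth step into the back step.
    extend : ∀ {P : Set} (f : P → X) (g : P → Y) (S : List P) →
      (∀ {p q} → p ∈ S → q ∈ S → f p X.≺ f q ⇔ g p Y.≺ g q) →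
      ∀ x → ∃ λ y → ∀ {p} → p ∈ S → (x X.≺ f p ⇔ y Y.≺ g p) × (f p X.≺ x ⇔ g p Y.≺ y)
    extend f g S iso x with lem {P = ∃ λ p → p ∈ S × f p X.≈ x}
    ... | yes (p , p∈S , p≼x , x≼p) = g p , λ q∈S →
        mk⇔ (λ x≺q → to (iso p∈S q∈S) (X.≼-≺-trans p≼x x≺q)) (λ p≺q → X.≼-≺-trans x≼p (from (iso p∈S q∈S) p≺q))
      , mk⇔ (λ q≺x → to (iso q∈S p∈S) (X.≺-≼-trans q≺x x≼p)) (λ q≺p → X.≺-≼-trans (from (iso q∈S p∈S) q≺p) p≼x)
    ... | no ∄p = y , λ q∈S →
        mk⇔ (y≺g q∈S) (λ y≺q → case-lower q∈S λ q≺x → Y.≺⇒≼ y≺q (g≺y q∈S q≺x))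
      , mk⇔ (g≺y q∈S) (λ q≺y → case-upper q∈S λ x≺q → Y.≺⇒≼ q≺y (y≺g q∈S x≺q))
      where
      lower upper : List _
      lower = filter (λ p → lem {P = f p X.≺ x}) S
      upper = filter (λ p → lem {P = x X.≺ f p}) S

      separated : All (λ l → All (l Y.≺_) (map g upper)) (map g lower)
      separated = All.tabulate λ l∈ → All.tabulate λ u∈ → sep (∈-map⁻ g l∈) (∈-map⁻ g u∈)
        where
        sep : ∀ {l u} → (∃ λ p → p ∈ lower × l ≡ g p) → (∃ λ p → p ∈ upper × u ≡ g p) → l Y.≺ u
        sep (p , p∈ , refl) (q , q∈ , refl) =
          let p∈S , p≺x = ∈-filter⁻ (λ p → lem {P = f p X.≺ x}) {xs = S} p∈
              q∈S , x≺q = ∈-filter⁻ (λ p → lem {P = x X.≺ f p}) {xs = S} q∈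
          in to (iso p∈S q∈S) (X.≺-trans p≺x x≺q)

      interpolant : ∃ λ y → All (Y._≺ y) (map g lower) × All (y Y.≺_) (map g upper)
      interpolant = Interpolation.interpolate OY DY _ _ separated

      y : Y
      y = proj₁ interpolant

      g≺y : ∀ {p} → p ∈ S → f p X.≺ x → g p Y.≺ y
      g≺y p∈S p≺x = All.lookup (proj₁ (proj₂ interpolant)) (∈-map⁺ g (∈-filter⁺ _ p∈S p≺x))

      y≺g : ∀ {p} → p ∈ S → x X.≺ f p → y Y.≺ g p
      y≺g p∈S x≺p = All.lookup (proj₂ (proj₂ interpolant)) (∈-map⁺ g (∈-filter⁺ _ p∈S x≺p))

      case-lower : ∀ {p} → p ∈ S → ¬ f p X.≺ x → x X.≺ f p
      case-lower {p} p∈S p≮x with lem {P = x X.≺ f p}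
      ... | yes x≺p = x≺p
      ... | no x≮p  = contradiction (p , p∈S , x≮p , p≮x) ∄p

      case-upper : ∀ {p} → p ∈ S → ¬ x X.≺ f p → f p X.≺ x
      case-upper {p} p∈S x≮p with lem {P = f p X.≺ x}
      ... | yes p≺x = p≺x
      ... | no p≮x  = contradiction (p , p∈S , x≮p , p≮x) ∄p

  module _ {X Y : Set} (OX : StrictWeakOrder X) (OY : StrictWeakOrder Y)
           (DX : Dense OX) (DY : Dense OY) (xs : ℕ → X) (ys : ℕ → Y) where
    private
      module X = StrictWeakOrder OX
      module Y = StrictWeakOrder OY

    PartialIso : List (X × Y) → Set
    PartialIso S = ∀ {p q} → p ∈ S → q ∈ S → proj₁ p X.≺ proj₁ q ⇔ proj₂ p Y.≺ proj₂ q

    insert : ∀ {S x y} → PartialIso S →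
      (∀ {p} → p ∈ S → (x X.≺ proj₁ p ⇔ y Y.≺ proj₂ p) × (proj₁ p X.≺ x ⇔ proj₂ p Y.≺ y)) →
      PartialIso ((x , y) ∷ S)
    insert iso ok (here refl) (here refl) = mk⇔ (λ p → contradiction p X.irrefl) (λ p → contradiction p Y.irrefl)
    insert iso ok (here refl) (there q∈)  = proj₁ (ok q∈)
    insert iso ok (there p∈)  (here refl) = proj₂ (ok p∈)
    insert iso ok (there p∈)  (there q∈)  = iso p∈ q∈

    forth : ∀ {S} → PartialIso S → ∀ x → ∃ λ y → PartialIso ((x , y) ∷ S)
    forth {S} iso x = let y , ok = extend OX OY DY proj₁ proj₂ S iso x in y , insert iso ok

    back : ∀ {S} → PartialIso S → ∀ y → ∃ λ x → PartialIso ((x , y) ∷ S)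
    back {S} iso y =
      let x , ok = extend OY OX DX proj₂ proj₁ S (λ p∈ q∈ → ⇔-sym (iso p∈ q∈)) y
      in x , insert iso λ p∈ → ⇔-sym (proj₁ (ok p∈)) , ⇔-sym (proj₂ (ok p∈))

    chain : ℕ → Σ (List (X × Y)) PartialIso
    chain zero    = [] , λ ()
    chain (suc n) =
      let S , iso = chain n
          y , iso₁ = forth iso (xs n)
          x , iso₂ = back iso₁ (ys n)
      in (x , ys n) ∷ (xs n , y) ∷ S , iso₂

    chain-mono : ∀ {m n} → m ≤′ n → ∀ {p} → p ∈ proj₁ (chain m) → p ∈ proj₁ (chain n)
    chain-mono ℕ.≤′-refl       p∈ = p∈
    chain-mono (ℕ.≤′-step m≼n) p∈ = there (there (chain-mono m≼n p∈))

    chain-iso : ∀ m n {p q} → p ∈ proj₁ (chain m) → q ∈ proj₁ (chain n) →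
                proj₁ p X.≺ proj₁ q ⇔ proj₂ p Y.≺ proj₂ q
    chain-iso m n p∈ q∈ = proj₂ (chain (m ℕ.+ n))
      (chain-mono (ℕ.≤⇒≤′ (ℕ.m≤m+n m n)) p∈) (chain-mono (ℕ.≤⇒≤′ (ℕ.m≤n+m n m)) q∈)

    -- Any two pairs of the construction lie in a common finite partial isomorphism. The partner of
    -- y from a back step and the pair that defines φ there may differ, but only up to `≈`.
    back-and-forth : (∀ x → ∃ λ n → xs n X.≈ x) → (∀ y → ∃ λ n → ys n ≡ y) →
      Σ (X → Y) λ φ → (∀ {a b} → a X.≺ b ⇔ φ a Y.≺ φ b) × (∀ y → ∃ λ x → φ x Y.≈ y)
    back-and-forth xs-onto ys-onto = φ , (λ {a} {b} → mk⇔ (mono a b) (cancel a b)) , onto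
      where
      index : X → ℕ
      index x = proj₁ (xs-onto x)

      x≈ : ∀ x → xs (index x) X.≈ x
      x≈ x = proj₂ (xs-onto x)

      -- This is the very partner that stage `index x` adds, so `φ∈` holds by construction.
      φ : X → Y
      φ x = proj₁ (forth (proj₂ (chain (index x))) (xs (index x)))

      φ∈ : ∀ x → (xs (index x) , φ x) ∈ proj₁ (chain (suc (index x)))
      φ∈ x = there (here refl)

      mono : ∀ a b → a X.≺ b → φ a Y.≺ φ b
      mono a b a≺b = to (chain-iso (suc (index a)) (suc (index b)) (φ∈ a) (φ∈ b))
        (X.≼-≺-trans (proj₁ (x≈ a)) (X.≺-≼-trans a≺b (proj₂ (x≈ b))))

      cancel : ∀ a b → φ a Y.≺ φ b → a X.≺ b
      cancel a b φa≺φb = X.≼-≺-trans (proj₂ (x≈ a))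
        (X.≺-≼-trans (from (chain-iso (suc (index a)) (suc (index b)) (φ∈ a) (φ∈ b)) φa≺φb) (proj₁ (x≈ b)))

      onto : ∀ y → ∃ λ x → φ x Y.≈ y
      onto y with ys-onto y
      ... | n , refl = x
          , (λ y≺φx → proj₁ (x≈ x) (from (chain-iso (suc n) (suc (index x)) (here refl) (φ∈ x)) y≺φx))
          , (λ φx≺y → proj₂ (x≈ x) (from (chain-iso (suc (index x)) (suc n) (φ∈ x) (here refl)) φx≺y))
        where x = proj₁ (back (proj₂ (forth (proj₂ (chain n)) (xs n))) (ys n))

-- Orders of type ω + ζη

record DiscreteOrder (A : Set) : Set₁ where
  field
    order : StrictWeakOrder A
  open StrictWeakOrder order public
  field
    ⊥       : A
    ⊥-least : ∀ a → ⊥ ≼ a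
    S       : A → A
    ≺-S     : ∀ a → a ≺ S a
    S-least : ∀ {a b} → a ≺ b → S a ≼ b
    pred-S  : ∀ {a} → ⊥ ≺ a → ∃ λ b → S b ≈ a

  S^ : ℕ → A → A
  S^ zero    a = a
  S^ (suc n) a = S (S^ n a)

  infix 4 _≪_
  _≪_ : A → A → Set
  a ≪ b = ∀ n → S^ n a ≺ b

-- The blocks of finitely distant elements other than the first are ordered
-- like ℚ by Cantor's theorem; a base point in each block then identifies the
-- block with ℤ.
module OmegaZetaEtaType
  (lem : ExcludedMiddle 0ℓ) {A : Set} (O : DiscreteOrder A)
  (code : A → ℕ)
  (code-≈ : ∀ a b → code a ≡ code b → DiscreteOrder._≈_ O a b)
  (≪-dense : ∀ a b → DiscreteOrder._≪_ O a b →
             ∃ λ c → DiscreteOrder._≪_ O a c × DiscreteOrder._≪_ O c b)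
  (≪-above : ∀ a → ∃ λ b → DiscreteOrder._≪_ O a b) where

  open DiscreteOrder O
  open Classical lem

  S-mono-≼ : ∀ {a b} → a ≼ b → S a ≼ S b
  S-mono-≼ {b = b} a≼b = S-least (≼-≺-trans a≼b (≺-S b))

  S-mono-≺ : ∀ {a b} → a ≺ b → S a ≺ S b
  S-mono-≺ {b = b} a≺b = ≼-≺-trans (S-least a≺b) (≺-S b)

  S-mono-≈ : ∀ {a b} → a ≈ b → S a ≈ S b
  S-mono-≈ (p , q) = S-mono-≼ p , S-mono-≼ q

  S-cancel-≺ : ∀ {a b} → S a ≺ S b → a ≺ b
  S-cancel-≺ {a} {b} Sa≺Sb with lem {P = a ≺ b}
  ... | yes a≺b = a≺b
  ... | no b≼a  = contradiction Sa≺Sb (S-mono-≼ b≼a)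

  S^-mono-≺ : ∀ n {a b} → a ≺ b → S^ n a ≺ S^ n b
  S^-mono-≺ zero    a≺b = a≺b
  S^-mono-≺ (suc n) a≺b = S-mono-≺ (S^-mono-≺ n a≺b)

  S^-mono-≈ : ∀ n {a b} → a ≈ b → S^ n a ≈ S^ n b
  S^-mono-≈ zero    a≈b = a≈b
  S^-mono-≈ (suc n) a≈b = S-mono-≈ (S^-mono-≈ n a≈b)

  S^-+ : ∀ m n a → S^ m (S^ n a) ≡ S^ (m ℕ.+ n) a
  S^-+ zero    n a = refl
  S^-+ (suc m) n a = cong S (S^-+ m n a)

  S^-monoˡ-≼ : ∀ {m n} a → m ℕ.≤′ n → S^ m a ≼ S^ n a
  S^-monoˡ-≼ a ℕ.≤′-refl       = ≼-refl
  S^-monoˡ-≼ a (ℕ.≤′-step m≼n) = ≼-trans (S^-monoˡ-≼ a m≼n) (≺⇒≼ (≺-S _))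

  S^-cancel-≺ : ∀ {m n a} → S^ m a ≺ S^ n a → m ℕ.< n
  S^-cancel-≺ {m} {n} {a} p = ℕ.≰⇒> λ n≼m → S^-monoˡ-≼ a (ℕ.≤⇒≤′ n≼m) p

  S^-injective : ∀ {m n a} → S^ m a ≈ S^ n a → m ≡ n
  S^-injective {m} {n} {a} (p , q) = ℕ.≤-antisym
    (ℕ.≮⇒≥ λ n≺m → p (≺-≼-trans (≺-S (S^ n a)) (S^-monoˡ-≼ a (ℕ.≤⇒≤′ n≺m))))
    (ℕ.≮⇒≥ λ m≺n → q (≺-≼-trans (≺-S (S^ m a)) (S^-monoˡ-≼ a (ℕ.≤⇒≤′ m≺n))))

  S^-cover : ∀ n {a b} → a ≼ b → b ≼ S^ n a → ∃ λ m → S^ m a ≈ b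
  S^-cover zero    a≼b b≼a = 0 , a≼b , b≼a
  S^-cover (suc n) {a} {b} a≼b b≼S with lem {P = S^ n a ≺ b}
  ... | yes Sⁿa≺b = suc n , S-least Sⁿa≺b , b≼S
  ... | no b≼Sⁿa  = S^-cover n a≼b b≼Sⁿa

  ¬≪⇒S^ : ∀ {a b} → a ≼ b → ¬ a ≪ b → ∃ λ n → S^ n a ≈ b
  ¬≪⇒S^ {a} {b} a≼b ¬a≪b with lem {P = ∃ λ n → b ≼ S^ n a}
  ... | yes (n , b≼) = S^-cover n a≼b b≼
  ... | no ∄n = contradiction (λ n → decidable-stable lem λ b≼ → ∄n (n , b≼)) ¬a≪b

  ≪-≼-trans : ∀ {a b c} → a ≪ b → b ≼ c → a ≪ c
  ≪-≼-trans a≪b b≼c n = ≺-≼-trans (a≪b n) b≼c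

  ≪-S : ∀ {a b} → a ≪ S b → a ≪ b
  ≪-S a≪Sb n = S-cancel-≺ (a≪Sb (suc n))

  ≪-S^ : ∀ n {a b} → a ≪ S^ n b → a ≪ b
  ≪-S^ zero    a≪b = a≪b
  ≪-S^ (suc n) a≪b = ≪-S^ n (≪-S a≪b)

  ≪-compare : ∀ {a b} → a ≪ b → ∀ c → a ≪ c ⊎ c ≪ b
  ≪-compare {a} {b} a≪b c with lem {P = a ≪ c}
  ... | yes a≪c = inj₁ a≪c
  ... | no ¬a≪c with lem {P = c ≺ a}
  ...   | yes c≺a = inj₂ λ n → ≺-≼-trans (S^-mono-≺ n c≺a) (≺⇒≼ (a≪b n))
  -- Here c is m successors above a, so n successors of c are n + m successors of a.
  ...   | no a≼c  = let m , Sᵐa≈c = ¬≪⇒S^ a≼c ¬a≪c in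
    inj₂ λ n → ≼-≺-trans (proj₂ (S^-mono-≈ n Sᵐa≈c)) (subst (_≺ b) (sym (S^-+ n m a)) (a≪b (n ℕ.+ m)))

  Infinite-element : Set
  Infinite-element = Σ A λ a → ⊥ ≪ a

  -- Incomparability here means finite distance, so Cantor's theorem orders blocks rather than
  -- elements.
  block-order : StrictWeakOrder Infinite-element
  block-order = record
    { _≺_     = λ a b → proj₁ a ≪ proj₁ b
    ; irrefl  = λ a≪a → irrefl (a≪a 0)
    ; ≺-trans = λ a≪b b≪c → ≪-≼-trans a≪b (≺⇒≼ (b≪c 0))
    ; compare = λ a≪b c → ≪-compare a≪b (proj₁ c)
    }

  block-dense : Dense block-order
  block-dense = record
    { point   = ≪-above ⊥
    ; below   = λ (a , ⊥≪a) → let b , ⊥≪b , b≪a = ≪-dense ⊥ a ⊥≪a in (b , ⊥≪b) , b≪a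
    ; above   = λ (a , ⊥≪a) → let b , a≪b = ≪-above a in (b , ≪-≼-trans ⊥≪a (≺⇒≼ (a≪b 0))) , a≪b
    ; between = λ {(a , ⊥≪a)} {(b , _)} a≪b → let c , a≪c , c≪b = ≪-dense a b a≪b in
                (c , ≪-≼-trans ⊥≪a (≺⇒≼ (a≪c 0))) , a≪c , c≪b
    }

  enum : ℕ → Infinite-element
  enum n with lem {P = ∃ λ (a : Infinite-element) → code (proj₁ a) ≡ n}
  ... | yes (a , _) = a
  -- A number that codes no infinite element is sent to an arbitrary one.
  ... | no _        = ≪-above ⊥

  enum-onto : ∀ a → ∃ λ n → StrictWeakOrder._≈_ block-order (enum n) a
  enum-onto a = code (proj₁ a) , lemma
    where
    lemma : StrictWeakOrder._≈_ block-order (enum (code (proj₁ a))) a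
    lemma with lem {P = ∃ λ (b : Infinite-element) → code (proj₁ b) ≡ code (proj₁ a)}
    ... | yes (b , eq) = let b≼a , a≼b = code-≈ (proj₁ b) (proj₁ a) eq in
                         (λ a≪b → b≼a (a≪b 0)) , (λ b≪a → a≼b (b≪a 0))
    ... | no ∄b        = contradiction (a , refl) ∄b

  private
    cantor = back-and-forth block-order ℚ-order block-dense ℚ-dense enum enumℚ enum-onto enumℚ-surjective

  block : Infinite-element → ℚ
  block = proj₁ cantor

  block-≺ : ∀ a b → proj₁ a ≪ proj₁ b ⇔ block a ℚ.< block b
  block-≺ a b = proj₁ (proj₂ cantor) {a} {b}

  ℚ-≈⇒≡ : ∀ {p q} → ¬ q ℚ.< p → ¬ p ℚ.< q → p ≡ q
  ℚ-≈⇒≡ q≮p p≮q = ℚ.≤-antisym (ℚ.≮⇒≥ q≮p) (ℚ.≮⇒≥ p≮q)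

  block-≡ : ∀ a b → ¬ proj₁ b ≪ proj₁ a → ¬ proj₁ a ≪ proj₁ b → block a ≡ block b
  block-≡ a b b≪̸a a≪̸b = ℚ-≈⇒≡ (λ p → b≪̸a (from (block-≺ b a) p)) (λ p → a≪̸b (from (block-≺ a b) p))

  base : ℚ → Infinite-element
  base q = proj₁ (proj₂ (proj₂ cantor) q)

  block-base : ∀ q → block (base q) ≡ q
  block-base q = let p , r = proj₂ (proj₂ (proj₂ cantor) q) in ℚ-≈⇒≡ p r

  -- The integer is a formal difference: m successors of the base point meet n successors of a. This
  -- treats both sides of the base point alike without iterated predecessors; many pairs (m , n)
  -- witness one position, and `offset-≡` reconciles them.
  Position : A → OmegaZetaEta → Set
  Position a (inj₁ n)       = S^ n ⊥ ≈ a
  Position a (inj₂ (z , q)) = Σ (⊥ ≪ a) λ ⊥≪a → block (a , ⊥≪a) ≡ q ×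
    ∃ λ m → ∃ λ n → m ⊖ n ≡ z × S^ m (proj₁ (base q)) ≈ S^ n a

  ¬≪-S^⊥ : ∀ {a} n → S^ n ⊥ ≈ a → ¬ ⊥ ≪ a
  ¬≪-S^⊥ n (_ , a≼) ⊥≪a = a≼ (⊥≪a n)

  position : ∀ a → ∃ (Position a)
  position a with lem {P = ⊥ ≪ a}
  ... | no ¬⊥≪a = let n , p = ¬≪⇒S^ (⊥-least a) ¬⊥≪a in inj₁ n , p
  ... | yes ⊥≪a = inj₂ (_ , q) , ⊥≪a , refl , proj₁ offset , proj₁ (proj₂ offset) , refl , proj₂ (proj₂ offset)
    where
    q : ℚ
    q = block (a , ⊥≪a)
    r : A
    r = proj₁ (base q)
    ¬r≪a : ¬ r ≪ a
    ¬r≪a r≪a = ℚ.<-irrefl (block-base q) (to (block-≺ (base q) (a , ⊥≪a)) r≪a)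
    ¬a≪r : ¬ a ≪ r
    ¬a≪r a≪r = ℚ.<-irrefl (sym (block-base q)) (to (block-≺ (a , ⊥≪a) (base q)) a≪r)
    offset : ∃ λ m → ∃ λ n → S^ m r ≈ S^ n a
    offset with lem {P = a ≺ r}
    ... | yes a≺r = let n , p = ¬≪⇒S^ (≺⇒≼ a≺r) ¬a≪r in 0 , n , ≈-sym p
    ... | no r≼a  = let m , p = ¬≪⇒S^ r≼a ¬r≪a in m , 0 , p

  S^-shift : ∀ {r a} m n k → S^ m r ≈ S^ n a → S^ (m ℕ.+ k) r ≈ S^ (n ℕ.+ k) a
  S^-shift m n k p = subst₂ _≈_ (S^-+-comm m) (S^-+-comm n) (S^-mono-≈ k p)
    where
    S^-+-comm : ∀ {a} l → S^ k (S^ l a) ≡ S^ (l ℕ.+ k) a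
    S^-+-comm {a} l = trans (S^-+ k l a) (cong (λ j → S^ j a) (ℕ.+-comm k l))

  ⊖-+ʳ : ∀ m n k → (m ℕ.+ k) ⊖ (n ℕ.+ k) ≡ m ⊖ n
  ⊖-+ʳ m n k = trans (cong₂ _⊖_ (ℕ.+-comm m k) (ℕ.+-comm n k)) (ℤ.+-cancelˡ-⊖ k m n)

  -- Raising a and b to the common height n + n′ turns their comparison into that of m + n′ with m′
  -- + n, the cross sums of the two differences.
  offset-≺ : ∀ {r a b} m n m′ n′ → S^ m r ≈ S^ n a → S^ m′ r ≈ S^ n′ b → a ≺ b → m ⊖ n ℤ.< m′ ⊖ n′
  offset-≺ {r} {a} {b} m n m′ n′ p p′ a≺b = subst₂ ℤ._<_ (⊖-+ʳ m n n′)
    (trans (cong ((m′ ℕ.+ n) ⊖_) (ℕ.+-comm n n′)) (⊖-+ʳ m′ n′ n))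
    (ℤ.⊖-monoˡ-< (n ℕ.+ n′) (S^-cancel-≺
      (≼-≺-trans (proj₁ (S^-shift m n n′ p))
        (≺-≼-trans (S^-mono-≺ (n ℕ.+ n′) a≺b)
          (subst (λ k → S^ k b ≼ S^ (m′ ℕ.+ n) r) (ℕ.+-comm n′ n) (proj₂ (S^-shift m′ n′ n p′)))))))

  offset-≡ : ∀ {r a} m n m′ n′ → S^ m r ≈ S^ n a → S^ m′ r ≈ S^ n′ a → m ⊖ n ≡ m′ ⊖ n′
  offset-≡ {r} {a} m n m′ n′ p p′ = begin
    m ⊖ n                     ≡⟨ ⊖-+ʳ m n n′ ⟨
    (m ℕ.+ n′) ⊖ (n ℕ.+ n′)   ≡⟨ cong₂ _⊖_ cross (ℕ.+-comm n n′) ⟩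
    (m′ ℕ.+ n) ⊖ (n′ ℕ.+ n)   ≡⟨ ⊖-+ʳ m′ n′ n ⟩
    m′ ⊖ n′                   ∎
    where
    open ≡-Reasoning
    cross : m ℕ.+ n′ ≡ m′ ℕ.+ n
    cross = S^-injective (≈-trans (S^-shift m n n′ p)
      (subst (λ k → S^ k a ≈ S^ (m′ ℕ.+ n) r) (ℕ.+-comm n′ n) (≈-sym (S^-shift m′ n′ n p′))))

  position-≺ : ∀ {a b} t u → Position a t → Position b u → a ≺ b → t <ωζη u
  position-≺ (inj₁ m) (inj₁ n) p p′ a≺b = ω<ω (S^-cancel-≺ (≼-≺-trans (proj₁ p) (≺-≼-trans a≺b (proj₂ p′))))
  position-≺ (inj₁ m) (inj₂ _) _ _ _ = ω<ζη
  position-≺ (inj₂ _) (inj₁ n) (⊥≪a , _) p a≺b = contradiction (≪-≼-trans ⊥≪a (≺⇒≼ a≺b)) (¬≪-S^⊥ n p)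
  position-≺ {a} {b} (inj₂ (_ , q)) (inj₂ (_ , q′))
    (⊥≪a , refl , m , n , refl , p) (⊥≪b , refl , m′ , n′ , refl , p′) a≺b
    with ℚ.<-cmp q q′
  ... | tri< q≺q′ _ _ = copy< q≺q′
  ... | tri> _ _ q′≺q = contradiction (from (block-≺ (b , ⊥≪b) (a , ⊥≪a)) q′≺q 0) (≺⇒≼ a≺b)
  ... | tri≈ _ q≡q′ _ = subst (λ q″ → inj₂ (_ , q) <ωζη inj₂ (_ , q″)) q≡q′
    (same< (offset-≺ m n m′ n′ p (subst (λ q″ → S^ m′ (proj₁ (base q″)) ≈ S^ n′ b) (sym q≡q′) p′) a≺b))

  position-≡ : ∀ {a b} t u → Position a t → Position b u → a ≈ b → t ≡ u
  position-≡ (inj₁ m) (inj₁ n) p p′ a≈b = cong inj₁ (S^-injective (≈-trans p (≈-trans a≈b (≈-sym p′))))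
  position-≡ (inj₁ m) (inj₂ _) p (⊥≪b , _) (_ , b≼a) = contradiction (≪-≼-trans ⊥≪b b≼a) (¬≪-S^⊥ m p)
  position-≡ (inj₂ _) (inj₁ n) (⊥≪a , _) p (a≼b , _) = contradiction (≪-≼-trans ⊥≪a a≼b) (¬≪-S^⊥ n p)
  position-≡ {a} {b} (inj₂ (_ , q)) (inj₂ (_ , q′))
    (⊥≪a , refl , m , n , refl , p) (⊥≪b , refl , m′ , n′ , refl , p′) a≈b@(a≼b , b≼a) =
    cong inj₂ (cong₂ _,_ (offset-≡ m n m′ n′ p (subst (λ q″ → S^ m′ (proj₁ (base q″)) ≈ S^ n′ a) (sym q≡q′)
      (≈-trans p′ (S^-mono-≈ n′ (≈-sym a≈b))))) q≡q′)
    where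
    q≡q′ : q ≡ q′
    q≡q′ = block-≡ (a , ⊥≪a) (b , ⊥≪b) (λ b≪a → a≼b (b≪a 0)) (λ a≪b → b≼a (a≪b 0))

  -- Predecessors never run out: one step down from an element infinitely far above `⊥` is still
  -- infinitely far above it.
  descend : ∀ n {r} → ⊥ ≪ r → ∃ λ a → ⊥ ≪ a × S^ n a ≈ r
  descend zero    {r} ⊥≪r = r , ⊥≪r , ≈-refl
  descend (suc n) {r} ⊥≪r =
    let b , Sb≈r = pred-S (⊥≪r 0)
        a , ⊥≪a , p = descend n (≪-S (≪-≼-trans ⊥≪r (proj₂ Sb≈r)))
    in a , ⊥≪a , ≈-trans (S-mono-≈ p) Sb≈r

  position-onto : ∀ t → ∃ λ a → Position a t
  position-onto (inj₁ n) = S^ n ⊥ , ≈-refl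
  position-onto (inj₂ (z , q)) = inBlock z
    where
    r : A
    r = proj₁ (base q)
    ⊥≪r : ⊥ ≪ r
    ⊥≪r = proj₂ (base q)
    ≼-S^ : ∀ n a → a ≼ S^ n a
    ≼-S^ n a = S^-monoˡ-≼ {0} {n} a (ℕ.≤⇒≤′ ℕ.z≤n)
    place : ∀ a m n → S^ m r ≈ S^ n a → ∃ λ a → Position a (inj₂ (m ⊖ n , q))
    place a m n p = a , ⊥≪a , trans (block-≡ (a , ⊥≪a) (base q) ¬r≪a ¬a≪r) (block-base q) , m , n , refl , p
      where
      ⊥≪a : ⊥ ≪ a
      ⊥≪a = ≪-S^ n (≪-≼-trans ⊥≪r (≼-trans (≼-S^ m r) (proj₁ p)))
      ¬r≪a : ¬ r ≪ a
      ¬r≪a r≪a = proj₂ p (≺-≼-trans (r≪a m) (≼-S^ n a))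
      ¬a≪r : ¬ a ≪ r
      ¬a≪r a≪r = proj₁ p (≺-≼-trans (a≪r n) (≼-S^ m r))
    inBlock : ∀ z → ∃ λ a → Position a (inj₂ (z , q))
    inBlock (ℤ.+ n)    = place (S^ n r) n 0 (≈-refl {S^ n r})
    inBlock ℤ.-[1+ n ] = let a , _ , p = descend (suc n) ⊥≪r in place a 0 (suc n) (≈-sym p)

  <ωζη-irrefl : ∀ {t} → ¬ t <ωζη t
  <ωζη-irrefl (ω<ω p)   = ℕ.<-irrefl refl p
  <ωζη-irrefl (copy< p) = ℚ.<-irrefl refl p
  <ωζη-irrefl (same< p) = ℤ.<-irrefl refl p

  <ωζη-asym : ∀ {t u} → t <ωζη u → ¬ u <ωζη t
  <ωζη-asym (ω<ω p)   (ω<ω q)   = ℕ.<-asym p q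
  <ωζη-asym (copy< p) (copy< q) = ℚ.<-asym p q
  <ωζη-asym (copy< p) (same< q) = ℚ.<-irrefl refl p
  <ωζη-asym (same< p) (copy< q) = ℚ.<-irrefl refl q
  <ωζη-asym (same< p) (same< q) = ℤ.<-asym p q

  toωζη : A → OmegaZetaEta
  toωζη a = proj₁ (position a)

  private
    pos : ∀ a → Position a (toωζη a)
    pos a = proj₂ (position a)

  toωζη-mono : ∀ {a b} → a ≺ b → toωζη a <ωζη toωζη b
  toωζη-mono {a} {b} = position-≺ (toωζη a) (toωζη b) (pos a) (pos b)

  toωζη-cong : ∀ {a b} → a ≈ b → toωζη a ≡ toωζη b
  toωζη-cong {a} {b} = position-≡ (toωζη a) (toωζη b) (pos a) (pos b)

  toωζη-cancel : ∀ {a b} → toωζη a <ωζη toωζη b → a ≺ b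
  toωζη-cancel {a} {b} p with lem {P = a ≺ b}
  ... | yes a≺b = a≺b
  ... | no b≼a with lem {P = b ≺ a}
  ...   | yes b≺a = contradiction (toωζη-mono b≺a) (<ωζη-asym p)
  ...   | no a≼b  = contradiction (subst (_<ωζη toωζη b) (toωζη-cong (a≼b , b≼a)) p) <ωζη-irrefl

  toωζη-injective : ∀ {a b} → toωζη a ≡ toωζη b → a ≈ b
  toωζη-injective {a} {b} eq =
      (λ b≺a → <ωζη-irrefl (subst (toωζη b <ωζη_) eq (toωζη-mono b≺a)))
    , (λ a≺b → <ωζη-irrefl (subst (toωζη a <ωζη_) (sym eq) (toωζη-mono a≺b)))

  toωζη-onto : ∀ t → ∃ λ a → toωζη a ≡ t
  toωζη-onto t = let a , p = position-onto t in a , position-≡ (toωζη a) t (pos a) p ≈-refl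

-- The presentation 𝓛

double-mono-≤ : ∀ {a b} → a ≤ b → a + a ≤ b + b
double-mono-≤ a≤b = +-mono-≤ a≤b a≤b

double-mono-< : ∀ {a b} → a < b → suc (a + a) < b + b
double-mono-< {a} {b} a<b = ≤-trans (≤-reflexive (cong suc (sym (+-suc a a)))) (double-mono-≤ a<b)

double-injective : ∀ {a b} → a + a ≡ b + b → a ≡ b
double-injective {a} {b} eq with <-cmp a b
... | tri< a<b _ _ = contradiction eq (<⇒≢ (<-trans (n<1+n _) (double-mono-< a<b)))
... | tri≈ _ a≡b _ = a≡b
... | tri> _ _ b<a = contradiction (sym eq) (<⇒≢ (<-trans (n<1+n _) (double-mono-< b<a)))

odd≢even : ∀ a b → suc (a + a) ≢ b + b
odd≢even a b eq with a <? b
... | yes a<b = <⇒≢ (double-mono-< a<b) eq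
... | no a≮b  = <⇒≢ (s≤s (double-mono-≤ (≮⇒≥ a≮b))) (sym eq)

even-or-odd : ∀ v → ∃ λ a → v ≡ a + a ⊎ v ≡ suc (a + a)
even-or-odd zero = 0 , inj₁ refl
even-or-odd (suc v) with even-or-odd v
... | a , inj₁ refl = a , inj₂ refl
... | a , inj₂ refl = suc a , inj₁ (cong suc (sym (+-suc a a)))

-- The domain consists of the pairs (a , 0), placed at 2a, and the pairs
-- (a , s + 1) such that program a halts on a with output 0 at stage s, placed
-- at 2a + 1; membership is expressed by the value 0.
member : ℕ → ℕ
member z = if0 (snd z) 0 (haltsAt (fst z) (pred (snd z)))

key : ℕ → ℕ
key z = if0 (snd z) 0 1 + (fst z + fst z)

member-c : Computable f → Computable λ xs → member (f xs)
member-c = app₁ {F = member} (if0-c (snd-c v0) (const-c 0) (haltsAt-c (fst-c v0) (pred-c (snd-c v0))))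

key-c : Computable f → Computable λ xs → key (f xs)
key-c = app₁ {F = key} (if0-c (snd-c v0) (const-c 0) (const-c 1) +c (fst-c v0 +c fst-c v0))

Member : ℕ → Set
Member z = member z ≡ 0

member-even : ∀ a → Member (pair a 0)
member-even a rewrite snd-pair a 0 = refl

key-even : ∀ a → key (pair a 0) ≡ a + a
key-even a rewrite snd-pair a 0 | fst-pair a 0 = refl

member-odd : ∀ a s → haltsAt a s ≡ 0 → Member (pair a (suc s))
member-odd a s h rewrite snd-pair a (suc s) | fst-pair a (suc s) = h

key-odd : ∀ a s → key (pair a (suc s)) ≡ suc (a + a)
key-odd a s rewrite snd-pair a (suc s) | fst-pair a (suc s) = refl

data Point (z : ℕ) : Set where
  even : ∀ a → z ≡ pair a 0 → key z ≡ a + a → Point z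
  odd  : ∀ a s → haltsAt a s ≡ 0 → z ≡ pair a (suc s) → key z ≡ suc (a + a) → Point z

point : ∀ z → Member z → Point z
point z = subst (λ z → Member z → Point z) (pair-fst-snd z) (view (fst z) (snd z))
  where
  view : ∀ a s → Member (pair a s) → Point (pair a s)
  view a zero    _ = even a refl (key-even a)
  view a (suc s) m rewrite snd-pair a (suc s) | fst-pair a (suc s) = odd a s m refl (key-odd a s)

-- Two names of one odd position would be two halting stages of one computation.
key-injective : ∀ {y z} → Member y → Member z → key y ≡ key z → y ≡ z
key-injective {y} {z} my mz eq with point y my | point z mz
... | even a refl p | even b refl q =
  cong (λ a → pair a 0) (double-injective (trans (sym p) (trans eq q)))
... | even a refl p | odd b t _ refl q = contradiction (trans (sym q) (trans (sym eq) p)) (odd≢even b a)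
... | odd a s _ refl p | even b refl q = contradiction (trans (sym p) (trans eq q)) (odd≢even a b)
... | odd a s h refl p | odd b t k refl q with double-injective {a} {b} (suc-injective (trans (sym p) (trans eq q)))
...   | refl = cong (λ s → pair a (suc s)) (haltsAt-unique a s t h k)

Key : ℕ → Set
Key v = ∃ λ z → Member z × key z ≡ v

Key-even : ∀ a → Key (a + a)
Key-even a = pair a 0 , member-even a , key-even a

Key-odd : ∀ a → Key (suc (a + a)) → ∃ λ s → haltsAt a s ≡ 0
Key-odd a (z , m , eq) with point z m
... | even b _ p = contradiction (trans (sym eq) p) (odd≢even a b)
... | odd b s h _ p with double-injective {b} {a} (suc-injective (trans (sym p) eq))
...   | refl = s , h

-- One of v and v + 1 is even.
Key-gap : ∀ v → Key v ⊎ Key (suc v)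
Key-gap v with even-or-odd v
... | a , inj₁ refl = inj₁ (Key-even a)
... | a , inj₂ refl = inj₂ (subst Key (cong suc (+-suc a a)) (Key-even (suc a)))

precedes : ℕ → ℕ → ℕ
precedes x y = if0 (suc (key x) ∸ key y) 1 0

opaque
  domain-c : Computable₁ λ z → if0 (member z) 1 0
  domain-c = if0-c (member-c v0) (const-c 1) (const-c 0)

precedes-c : Computable₂ precedes
precedes-c = if0-c (suc-c (key-c v0) ∸c key-c v1) (const-c 1) (const-c 0)

if0-cases : ∀ {n} {c : Code n} {xs} m → Eval c xs (if0 m 1 0) → Eval c xs 0 ⊎ Eval c xs 1
if0-cases zero    c⇓ = inj₂ c⇓
if0-cases (suc _) c⇓ = inj₁ c⇓

if0≡1 : ∀ {n} {c : Code n} {xs} m → Eval c xs (if0 m 1 0) → Eval c xs 1 ⇔ m ≡ 0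
if0≡1 zero    c⇓ = mk⇔ (λ _ → refl) (λ _ → c⇓)
if0≡1 (suc _) c⇓ = mk⇔ (λ c⇓1 → contradiction (⇓-functional c⇓1 c⇓) λ ()) (λ ())

dom⇔ : ∀ z → code domain-c ⟨ z ⟩⇓ 1 ⇔ Member z
dom⇔ z = if0≡1 (member z) (code⇓ domain-c (z ∷ []))

ord⇔ : ∀ x y → Eval (code precedes-c) (x ∷ y ∷ []) 1 ⇔ key x < key y
ord⇔ x y = mk⇔ (λ p → m∸n≡0⇒m≤n (to e p)) (λ p → from e (m≤n⇒m∸n≡0 p))
  where e = if0≡1 (suc (key x) ∸ key y) (code⇓ precedes-c (x ∷ y ∷ []))

𝓛 : ComputableLinearOrder
𝓛 = record
  { dom     = code domain-c
  ; ord     = code precedes-c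
  ; dom-tot = λ z → if0-cases (member z) (code⇓ domain-c (z ∷ []))
  ; ord-tot = λ x y → if0-cases (suc (key x) ∸ key y) (code⇓ precedes-c (x ∷ y ∷ []))
  ; irrefl  = λ x _ p → <-irrefl refl (to (ord⇔ x x) p)
  ; trans   = λ x y z _ _ _ p q → from (ord⇔ x z) (<-trans (to (ord⇔ x y) p) (to (ord⇔ y z) q))
  ; linear  = linear
  }
  where
  linear : ∀ x y → code domain-c ⟨ x ⟩⇓ 1 → code domain-c ⟨ y ⟩⇓ 1 →
           Eval (code precedes-c) (x ∷ y ∷ []) 1 ⊎ x ≡ y ⊎ Eval (code precedes-c) (y ∷ x ∷ []) 1
  linear x y Lx Ly with <-cmp (key x) (key y)
  ... | tri< p _ _ = inj₁ (from (ord⇔ x y) p)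
  ... | tri≈ _ p _ = inj₂ (inj₁ (key-injective (to (dom⇔ x) Lx) (to (dom⇔ y) Ly) p))
  ... | tri> _ _ p = inj₂ (inj₂ (from (ord⇔ y x) p))

-- The order type of 𝓛

module Rank (lem : ExcludedMiddle 0ℓ) where

  -- The number of elements of R below v. Its definition decides membership in R by excluded middle,
  -- so it yields no algorithm.
  count : ℕ → ℕ
  count zero = 0
  count (suc v) with lem {P = Key v}
  ... | yes _ = suc (count v)
  ... | no _  = count v

  count-Key : ∀ {v} → Key v → count (suc v) ≡ suc (count v)
  count-Key {v} k with lem {P = Key v}
  ... | yes _ = refl
  ... | no ¬k = contradiction k ¬k

  count-¬Key : ∀ {v} → ¬ Key v → count (suc v) ≡ count v
  count-¬Key {v} ¬k with lem {P = Key v}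
  ... | yes k = contradiction k ¬k
  ... | no _  = refl

  count-≤-suc : ∀ v → count v ≤ count (suc v)
  count-≤-suc v with lem {P = Key v}
  ... | yes _ = n≤1+n _
  ... | no _  = ≤-refl

  count-mono-≤ : ∀ {v w} → v ≤′ w → count v ≤ count w
  count-mono-≤ ≤′-refl               = ≤-refl
  count-mono-≤ (≤′-step {w} v≤w) = ≤-trans (count-mono-≤ v≤w) (count-≤-suc w)

  count-mono-< : ∀ {v w} → Key v → v < w → count v < count w
  count-mono-< k v<w = ≤-trans (≤-reflexive (sym (count-Key k))) (count-mono-≤ (≤⇒≤′ v<w))

  count-onto : ∀ n → ∃ λ v → Key v × count v ≡ n
  count-onto zero = 0 , Key-even 0 , refl
  count-onto (suc n) with count-onto n
  ... | v , k , refl with lem {P = Key (suc v)}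
  ...   | yes k′ = suc v , k′ , count-Key k
  ...   | no ¬k′ with Key-gap (suc v)
  ...     | inj₁ k′ = contradiction k′ ¬k′
  ...     | inj₂ k′ = suc (suc v) , k′ , trans (count-¬Key ¬k′) (count-Key k)

  typeω : HasTypeω 𝓛
  typeω = (λ x → count (key x)) , order , onto
    where
    order : ∀ x y → code domain-c ⟨ x ⟩⇓ 1 → code domain-c ⟨ y ⟩⇓ 1 →
            Eval (code precedes-c) (x ∷ y ∷ []) 1 ⇔ count (key x) < count (key y)
    order x y Lx Ly = mk⇔
      (λ p → count-mono-< (x , to (dom⇔ x) Lx , refl) (to (ord⇔ x y) p))
      (λ p → from (ord⇔ x y) (≰⇒> λ q → <⇒≱ p (count-mono-≤ (≤⇒≤′ q))))
    onto : ∀ n → ∃ λ x → code domain-c ⟨ x ⟩⇓ 1 × count (key x) ≡ n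
    onto n with count-onto n
    ... | _ , (x , m , refl) , eq = x , from (dom⇔ x) m , eq

-- A computable isomorphism f decides whether a point lies between those at 2a
-- and 2a + 2, since this happens iff their f-values differ by more than 1.
not-computably-ω : ¬ ComputablyIsoℕ 𝓛
not-computably-ω (e , f , e⇓ , f-iso , f-onto) =
  undecidable (code gap-c) gap (λ x → code⇓ gap-c (x ∷ [])) decides
  where
  Lin : ∀ {z} → Member z → code domain-c ⟨ z ⟩⇓ 1
  Lin {z} = from (dom⇔ z)

  f-< : ∀ {y z} → Member y → Member z → key y < key z ⇔ f y < f z
  f-< {y} {z} my mz = mk⇔ (λ p → to (f-iso y z (Lin my) (Lin mz)) (from (ord⇔ y z) p))
                          (λ p → to (ord⇔ y z) (from (f-iso y z (Lin my) (Lin mz)) p))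

  gap : ℕ → ℕ
  gap a = f (pair (suc a) 0) ∸ suc (f (pair a 0))

  f-even-c : Computable₁ (λ a → f (pair a 0))
  f-even-c = computable (comp e (code even-c ∷ [])) λ xs →
    comp⇓ (code⇓ even-c xs ∷ []) (e⇓ _ (Lin (member-even (lookup xs zero))))
    where
    even-c : Computable₁ (λ a → pair a 0)
    even-c = pair-c v0 (const-c 0)

  gap-c : Computable₁ gap
  gap-c = app₁ {F = λ a → f (pair a 0)} f-even-c (suc-c v0) ∸c suc-c f-even-c

  decides : ∀ a → (gap a ≡ 0 → ¬ ∃ λ s → haltsAt a s ≡ 0) × (gap a ≢ 0 → ∃ λ s → haltsAt a s ≡ 0)
  decides a = empty , inhabited
    where
    z z′ : ℕ
    z  = pair a 0
    z′ = pair (suc a) 0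

    empty : gap a ≡ 0 → ¬ ∃ λ s → haltsAt a s ≡ 0
    empty eq (s , h) = <⇒≱ (<-≤-trans below above) (m∸n≡0⇒m≤n eq)
      where
      u : ℕ
      u = pair a (suc s)
      below : suc (f z) < suc (f u)
      below = s≤s (to (f-< (member-even a) (member-odd a s h))
        (subst₂ _<_ (sym (key-even a)) (sym (key-odd a s)) (n<1+n _)))
      above : f u < f z′
      above = to (f-< (member-odd a s h) (member-even (suc a)))
        (subst₂ _<_ (sym (key-odd a s)) (sym (key-even (suc a))) (double-mono-< (n<1+n a)))

    inhabited : gap a ≢ 0 → ∃ λ s → haltsAt a s ≡ 0
    -- The point that f sends to f z + 1 lies strictly between z and z′, so its position can only be
    -- 2a + 1.
    inhabited gap≢0 with f-onto (suc (f z))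
    ... | u , Lu , eq = Key-odd a (u , u∈ , ≤-antisym upper lower)
      where
      u∈ : Member u
      u∈ = to (dom⇔ u) Lu
      lower : suc (a + a) ≤ key u
      lower = subst (_< key u) (key-even a)
        (from (f-< (member-even a) u∈) (≤-reflexive (sym eq)))
      upper : key u ≤ suc (a + a)
      upper = s≤s⁻¹ (≤-trans
        (from (f-< u∈ (member-even (suc a))) (subst (_< f z′) (sym eq) (m∸n≢0⇒n<m gap≢0)))
        (≤-reflexive (trans (key-even (suc a)) (cong suc (+-suc a a)))))

-- Cohesive powers of 𝓛

least-zero : (g : ℕ → ℕ) → ∀ u → g u ≡ 0 →
             ∃ λ m → g m ≡ 0 × (∀ z → z < m → ∃ λ v → g z ≡ suc v)
least-zero g u gu≡0 with g 0 in g0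
... | zero = 0 , g0 , λ _ ()
least-zero g zero    gu≡0 | suc w = contradiction (trans (sym g0) gu≡0) λ ()
least-zero g (suc u) gu≡0 | suc w with least-zero (λ z → g (suc z)) u gu≡0
... | m , gm≡0 , below = suc m , gm≡0 , λ { zero _ → w , g0 ; (suc z) (s≤s z<m) → below z z<m }

-- The source of c.e. sets: the domain of the μ-search is a projection of a computable relation.
module Search (t : ℕ → ℕ → ℕ) (t-c : Computable₂ t) where
  search : Code 1
  search = mu (code t-c)

  search-complete : ∀ {v} → (∃ λ u → t u v ≡ 0) → W search v
  search-complete {v} (u , tu≡0) with least-zero (λ u → t u v) u tu≡0
  ... | m , tm≡0 , below = m , mu⇓ (subst (Eval _ _) tm≡0 (code⇓ t-c (m ∷ v ∷ [])))
    λ z z<m → let w , eq = below z z<m in w , subst (Eval _ _) eq (code⇓ t-c (z ∷ v ∷ []))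

  search-sound : ∀ {v u} → search ⟨ v ⟩⇓ u → t u v ≡ 0
  search-sound {v} {u} (mu⇓ p _) = ⇓-functional (code⇓ t-c (u ∷ v ∷ [])) p

module Power (lem : ExcludedMiddle 0ℓ) (C : Pred) (C-cohesive : Cohesive C) where
  open CohesivePower 𝓛 C

  Almost : Pred → Set
  Almost X = C ⊆* X

  mapᵃ : ∀ {X Y : Pred} → (∀ x → X x → Y x) → Almost X → Almost Y
  mapᵃ f (N , h) = N , λ x N≤x c → f x (h x N≤x c)

  zipWithᵃ : ∀ {X Y Z : Pred} → (∀ x → X x → Y x → Z x) → Almost X → Almost Y → Almost Z
  zipWithᵃ f (N , h) (M , k) = N + M , λ x N+M≤x c →
    f x (h x (≤-trans (m≤m+n N M) N+M≤x) c) (k x (≤-trans (m≤n+m M N) N+M≤x) c)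

  infixr 4 _∩_
  _∩_ : ∀ {X Y : Pred} → Almost X → Almost Y → Almost (λ x → X x × Y x)
  _∩_ = zipWithᵃ λ x → _,_

  eventually : ∀ {X : Pred} N → (∀ x → N ≤ x → X x) → Almost X
  eventually N h = N , λ x N≤x _ → h x N≤x

  ¬Almost-⊥ : ∀ {X : Pred} → (∀ x → ¬ X x) → ¬ Almost X
  ¬Almost-⊥ empty (N , h) with proj₁ C-cohesive N
  ... | x , N≤x , c = empty x (h x N≤x c)

  opaque
    decide : ∀ e → Almost (W e) ⊎ Almost (λ x → ¬ W e x)
    decide e with proj₂ C-cohesive e
    ... | inj₁ (N , h) = inj₁ (N , λ x N≤x c → decidable-stable lem λ ¬w → h x N≤x (c , ¬w))
    ... | inj₂ (N , h) = inj₂ (N , λ x N≤x c w → h x N≤x (c , w))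

  -- Elements of the power are partial; a total function that some algorithm computes almost
  -- everywhere on C stands in for them, so pointwise arithmetic need not speak of divergence.
  record AlmostComputable (f : ℕ → ℕ) : Set where
    field
      algorithm  : Code 1
      algorithm⇓ : Almost λ x → algorithm ⟨ x ⟩⇓ f x
  open AlmostComputable

  computable₁ : ∀ {F} → Computable₁ F → AlmostComputable F
  computable₁ F-c = record { algorithm = code F-c ; algorithm⇓ = eventually 0 λ x _ → code⇓ F-c (x ∷ []) }

  lift₂ : ∀ {F f g} → Computable₂ F → AlmostComputable f → AlmostComputable g →
          AlmostComputable λ x → F (f x) (g x)
  lift₂ {f = f} {g} F-c f-c g-c = record
    { algorithm  = comp (code F-c) (algorithm f-c ∷ algorithm g-c ∷ [])
    ; algorithm⇓ = zipWithᵃ (λ x p q → comp⇓ (p ∷ q ∷ []) (code⇓ F-c (f x ∷ g x ∷ [])))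
                     (algorithm⇓ f-c) (algorithm⇓ g-c)
    }

  lift₁ : ∀ {F f} → Computable₁ F → AlmostComputable f → AlmostComputable λ x → F (f x)
  lift₁ {f = f} F-c f-c = record
    { algorithm  = comp (code F-c) (algorithm f-c ∷ [])
    ; algorithm⇓ = mapᵃ (λ x p → comp⇓ (p ∷ []) (code⇓ F-c (f x ∷ []))) (algorithm⇓ f-c)
    }

  decide-∃ : ∀ t {f} → Computable₂ t → AlmostComputable f →
    Almost (λ x → ∃ λ u → t u (f x) ≡ 0) ⊎ Almost (λ x → ¬ ∃ λ u → t u (f x) ≡ 0)
  decide-∃ t {f} t-c f-c with decide (comp search (algorithm f-c ∷ []))
    where open Search t t-c
  ... | inj₁ w  = inj₁ (zipWithᵃ found (algorithm⇓ f-c) w)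
    where
    open Search t t-c
    found : ∀ x → algorithm f-c ⟨ x ⟩⇓ f x → W (comp search (algorithm f-c ∷ [])) x →
            ∃ λ u → t u (f x) ≡ 0
    found x p (u , comp⇓ (q ∷ []) s) = u , subst (λ v → t u v ≡ 0) (⇓-functional q p) (search-sound s)
  ... | inj₂ ¬w = inj₂ (zipWithᵃ (λ x p ¬w found → let y , s = search-complete found in
                    ¬w (y , comp⇓ (p ∷ []) s)) (algorithm⇓ f-c) ¬w)
    where open Search t t-c

  -- A zero is the name of the point at position v. Searching for it leads from positions back to
  -- points of 𝓛.
  seek : ℕ → ℕ → ℕ
  seek u v = member u + dist (key u) v

  seek-c : Computable₂ seek
  seek-c = member-c v0 +c dist-c (key-c v0) v1

  seek⇒ : ∀ {u v} → seek u v ≡ 0 → Member u × key u ≡ v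
  seek⇒ {u} {v} eq = m+n≡0⇒m≡0 (member u) eq , dist≡0⇒≡ (key u) v (m+n≡0⇒n≡0 (member u) eq)

  seek⇐ : ∀ {u v} → Member u → key u ≡ v → seek u v ≡ 0
  seek⇐ {u} m refl = cong₂ _+_ m (dist-refl (key u))

  open Search seek seek-c

  decide-Key : ∀ {f} → AlmostComputable f → Almost (λ x → Key (f x)) ⊎ Almost (λ x → ¬ Key (f x))
  decide-Key f-c = Sum.map (mapᵃ λ { x (u , p) → u , seek⇒ p })
                           (mapᵃ λ { x ¬p (u , m , eq) → ¬p (u , seek⇐ m eq) })
                           (decide-∃ seek seek-c f-c)

  decide-< : ∀ {f g} → AlmostComputable f → AlmostComputable g →
    Almost (λ x → f x < g x) ⊎ Almost (λ x → g x ≤ f x)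
  decide-< {f} {g} f-c g-c = Sum.map
    (mapᵃ λ { x (_ , p) → m∸n≡0⇒m≤n p }) (mapᵃ λ x ¬p → ≮⇒≥ λ p → ¬p (0 , m≤n⇒m∸n≡0 p))
    -- A decidable question posed as an existential one with a dummy witness.
    (decide-∃ (λ _ w → w) v1 (lift₂ {F = λ a b → suc a ∸ b} (suc-c v0 ∸c v1) f-c g-c))

  -- An element is studied through the positions in ℕ of its values.
  opaque
    val : Elem → ℕ → ℕ
    val (e , _) x with lem {P = W e x}
    ... | yes (y , _) = key y
    -- An arbitrary value; only finitely many elements of C get it.
    ... | no _        = 0

    val-⇓ : ∀ (a : Elem) {x y} → proj₁ a ⟨ x ⟩⇓ y → val a x ≡ key y
    val-⇓ (e , _) {x} {y} p with lem {P = W e x}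
    ... | yes (z , q) = cong key (⇓-functional q p)
    ... | no ¬w       = contradiction (y , p) ¬w

  ⇓-val : ∀ a → Almost λ x → ∃ λ y → proj₁ a ⟨ x ⟩⇓ y × val a x ≡ key y
  ⇓-val a@(e , total , _) = mapᵃ (λ { x (y , p) → y , p , val-⇓ a p }) total

  val-c : ∀ a → AlmostComputable (val a)
  val-c a@(e , _) = record
    { algorithm  = comp (code key-code) (e ∷ [])
    ; algorithm⇓ = mapᵃ (λ { x (y , p , eq) → subst (Eval _ _) (sym eq) (comp⇓ (p ∷ []) (code⇓ key-code (y ∷ []))) })
                   (⇓-val a)
    }
    where
    key-code : Computable₁ key
    key-code = key-c v0

  val-Key : ∀ a → Almost λ x → Key (val a x)
  val-Key a@(e , _ , values) = mapᵃ (λ { x (y , p , eq) → y , to (dom⇔ y) (values x y p) , sym eq }) (⇓-val a)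

  opaque
    realise : ∀ {f} → AlmostComputable f → Almost (λ x → Key (f x)) →
              ∃ λ a → Almost λ x → val a x ≡ f x
    realise {f} f-c f-Key = a , zipWithᵃ (λ { x p (u , m , eq) → let y , q = search-complete (u , seek⇐ m eq) in
        trans (val-⇓ a (comp⇓ (p ∷ []) q)) (proj₂ (seek⇒ (search-sound q))) }) (algorithm⇓ f-c) f-Key
      where
      a : Elem
      a = comp search (algorithm f-c ∷ [])
        , zipWithᵃ (λ { x p (u , m , eq) → let y , q = search-complete (u , seek⇐ m eq) in
            y , comp⇓ (p ∷ []) q }) (algorithm⇓ f-c) f-Key
        , λ { x y (comp⇓ (_ ∷ []) q) → from (dom⇔ y) (proj₁ (seek⇒ (search-sound q))) }

  Key-suc : ∀ v → ¬ Key v → Key (suc v)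
  Key-suc v ¬k with Key-gap v
  ... | inj₁ k = contradiction k ¬k
  ... | inj₂ k = k

  Key-pred : ∀ v → ¬ Key v → Key (pred v)
  Key-pred zero    ¬k = contradiction (Key-even 0) ¬k
  Key-pred (suc v) ¬k with Key-gap v
  ... | inj₁ k = k
  ... | inj₂ k = contradiction k ¬k

  -- The clause `¬ Key w` makes v the nearest point of R on its side; minimality of successors rests
  -- on it.
  RoundsUp RoundsDown : ℕ → ℕ → Set
  RoundsUp v w   = v ≡ w ⊎ (v ≡ suc w × ¬ Key w)
  RoundsDown v w = v ≡ w ⊎ (v ≡ pred w × ¬ Key w)

  RoundsUp-≥ : ∀ {v w} → RoundsUp v w → w ≤ v
  RoundsUp-≥ (inj₁ refl)       = ≤-refl
  RoundsUp-≥ (inj₂ (refl , _)) = n≤1+n _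

  RoundsUp-≤ : ∀ {v w} → RoundsUp v w → v ≤ suc w
  RoundsUp-≤ (inj₁ refl)       = n≤1+n _
  RoundsUp-≤ (inj₂ (refl , _)) = ≤-refl

  opaque
    -- Membership of f x in R is constant almost everywhere on C, so one of the algorithms for f and
    -- f + 1 works for almost all x.
    up : ∀ {f} → AlmostComputable f →
         ∃ λ a → Almost λ x → RoundsUp (val a x) (f x)
    up f-c with decide-Key f-c
    ... | inj₁ k  = let a , eq = realise f-c k in a , mapᵃ (λ _ → inj₁) eq
    ... | inj₂ ¬k = let a , eq = realise (lift₁ {F = suc} (suc-c v0) f-c) (mapᵃ (λ x → Key-suc _) ¬k)
                    in a , zipWithᵃ (λ _ eq ¬k → inj₂ (eq , ¬k)) eq ¬k

  opaque
    down : ∀ {f} → AlmostComputable f →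
           ∃ λ a → Almost λ x → RoundsDown (val a x) (f x)
    down f-c with decide-Key f-c
    ... | inj₁ k  = let a , eq = realise f-c k in a , mapᵃ (λ _ → inj₁) eq
    ... | inj₂ ¬k = let a , eq = realise (lift₁ {F = pred} (pred-c v0) f-c) (mapᵃ (λ x → Key-pred _) ¬k)
                    in a , zipWithᵃ (λ _ eq ¬k → inj₂ (eq , ¬k)) eq ¬k

  -- The cohesive power as a discrete order

  order : StrictWeakOrder Elem
  order = record
    { _≺_     = λ a b → Almost λ x → val a x < val b x
    ; irrefl  = ¬Almost-⊥ λ x → <-irrefl refl
    ; ≺-trans = zipWithᵃ λ x → <-trans
    ; compare = λ {a} a<b c → Sum.map₂ (λ c≤a → zipWithᵃ (λ x → ≤-<-trans) c≤a a<b)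
                                (decide-< (val-c a) (val-c c))
    }

  open StrictWeakOrder order using (_≺_; _≼_; _≈_)

  ≼-pointwise : ∀ a b → Almost (λ x → val a x ≤ val b x) → a ≼ b
  ≼-pointwise a b a≤b b<a = ¬Almost-⊥ (λ x (p , q) → ≤⇒≯ p q) (a≤b ∩ b<a)

  ≈-pointwise : ∀ a b → Almost (λ x → val a x ≡ val b x) → a ≈ b
  ≈-pointwise a b eq = ≼-pointwise a b (mapᵃ (λ x → ≤-reflexive) eq)
                        , ≼-pointwise b a (mapᵃ (λ x p → ≤-reflexive (sym p)) eq)

  pointwise-≈ : ∀ a b → a ≈ b → Almost λ x → val a x ≡ val b x
  pointwise-≈ a b (a≤b , b≤a) with decide-< (val-c a) (val-c b) | decide-< (val-c b) (val-c a)
  ... | inj₁ a<b | _        = contradiction a<b b≤a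
  ... | inj₂ _   | inj₁ b<a = contradiction b<a a≤b
  ... | inj₂ q   | inj₂ p   = zipWithᵃ (λ x → ≤-antisym) p q

  opaque
    bottom : ∃ λ a → Almost λ x → val a x ≡ 0
    bottom = realise (computable₁ {λ _ → 0} (const-c 0)) (eventually 0 λ _ _ → Key-even 0)

    successor : ∀ a → ∃ λ b → Almost λ x → RoundsUp (val b x) (suc (val a x))
    successor a = up (lift₁ {F = suc} (suc-c v0) (val-c a))

  discrete : DiscreteOrder Elem
  discrete = record
    { order   = order
    ; ⊥       = proj₁ bottom
    ; ⊥-least = λ a → ≼-pointwise (proj₁ bottom) a (mapᵃ (λ x eq → subst (_≤ val a x) (sym eq) z≤n) (proj₂ bottom))
    ; S       = λ a → proj₁ (successor a)
    ; ≺-S     = λ a → mapᵃ (λ x → RoundsUp-≥) (proj₂ (successor a))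
    ; S-least = λ {a} {b} a<b → ≼-pointwise (proj₁ (successor a)) b
                  (mapᵃ (λ x (k , s , p) → least k s p) (val-Key b ∩ proj₂ (successor a) ∩ a<b))
    ; pred-S  = λ {a} ⊥<a →
        let b , b≈ = down (lift₁ {F = pred} (pred-c v0) (val-c a))
            Sb = proj₁ (successor b)
            0<a = zipWithᵃ (λ x eq p → subst (_< val a x) eq p) (proj₂ bottom) ⊥<a
        in b , ≈-pointwise Sb a (mapᵃ (λ x (p , k , q , r) → pred-successor p k q r)
                 (0<a ∩ (val-Key a ∩ val-Key Sb) ∩ b≈ ∩ proj₂ (successor b)))
    }
    where
    least : ∀ {va vs vb} → Key vb → RoundsUp vs (suc va) → va < vb → vs ≤ vb
    least k (inj₁ refl) p = p
    least k (inj₂ (refl , ¬k)) p = ≤∧≢⇒< p λ { refl → ¬k k }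

    -- If va - 1 is in R, it is the predecessor. Otherwise va - 2 is, and its successor rounds va -
    -- 1 up to va; here va = 1 is excluded because 0 is in R.
    pred-successor : ∀ {va vb vs} → 0 < va → Key va × Key vs →
      RoundsDown vb (pred va) → RoundsUp vs (suc vb) → vs ≡ va
    pred-successor {suc v} _ _ (inj₁ refl) (inj₁ refl) = refl
    pred-successor {suc v} _ (k , _) (inj₁ refl) (inj₂ (_ , ¬k)) = contradiction k ¬k
    pred-successor {suc zero} _ _ (inj₂ (_ , ¬k)) _ = contradiction (Key-even 0) ¬k
    pred-successor {suc (suc v)} _ (_ , k) (inj₂ (refl , ¬k)) (inj₁ refl) = contradiction k ¬k
    pred-successor {suc (suc v)} _ _ (inj₂ (refl , ¬k)) (inj₂ (refl , _)) = refl

  open DiscreteOrder discrete using (S^; _≪_)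

  S^-lower : ∀ n a → Almost λ x → val a x + n ≤ val (S^ n a) x
  S^-lower zero    a = eventually 0 λ x _ → ≤-reflexive (+-identityʳ (val a x))
  S^-lower (suc n) a = zipWithᵃ (λ x p q → ≤-trans (≤-reflexive (+-suc (val a x) n)) (≤-trans (s≤s p) q))
    (S^-lower n a) (DiscreteOrder.≺-S discrete (S^ n a))

  -- Each successor moves the position by one, plus at most one for rounding. With `S^-lower` this
  -- lets `≪` be tested on positions.
  S^-upper : ∀ n a → Almost λ x → val (S^ n a) x ≤ val a x + (n + n)
  S^-upper zero    a = eventually 0 λ x _ → ≤-reflexive (sym (+-identityʳ (val a x)))
  S^-upper (suc n) a = zipWithᵃ bound (S^-upper n a) (proj₂ (successor (S^ n a)))
    where
    +-suc-suc : ∀ v → suc (suc (v + (n + n))) ≡ v + (suc n + suc n)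
    +-suc-suc v = sym (trans (+-suc v (n + suc n)) (cong suc (trans (cong (v +_) (+-suc n n)) (+-suc v (n + n)))))
    bound : ∀ x → val (S^ n a) x ≤ val a x + (n + n) →
      RoundsUp (val (S^ (suc n) a) x) (suc (val (S^ n a) x)) →
      val (S^ (suc n) a) x ≤ val a x + (suc n + suc n)
    bound x p s = ≤-trans (RoundsUp-≤ s) (≤-trans (s≤s (s≤s p)) (≤-reflexive (+-suc-suc (val a x))))

  ≪⇒far : ∀ {a b} → a ≪ b → ∀ n → Almost λ x → val a x + n < val b x
  ≪⇒far {a} a≪b n = zipWithᵃ (λ x → ≤-<-trans) (S^-lower n a) (a≪b n)

  far⇒≪ : ∀ {a b} → (∀ n → Almost λ x → val a x + n < val b x) → a ≪ b
  far⇒≪ {a} far n = zipWithᵃ (λ x → ≤-<-trans) (S^-upper n a) (far (n + n))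

  ≪-above : ∀ a → ∃ λ b → a ≪ b
  ≪-above a = b , far⇒≪ {a} {b} λ n → zipWithᵃ
      (λ x n<x r → <-≤-trans (+-monoʳ-< (val a x) n<x) (RoundsUp-≥ r))
      (eventually (suc n) λ _ p → p) (proj₂ b-up)
    where
    -- The witness is φ(x) + x, since x eventually exceeds every fixed n.
    b-up = up (lift₂ {F = _+_} (v0 +c v1) (val-c a) (computable₁ {λ x → x} v0))
    b = proj₁ b-up

  average : ℕ → ℕ → ℕ
  average u v = u + ⌊ v ∸ u /2⌋

  -- Both halves of the interval have length at least 2 + n. On the upper side one unit pays for
  -- rounding the midpoint up and one for strictness.
  average-far : ∀ n {u v} → u + ((2 + n) + (2 + n)) < v →
                u + n < average u v × suc (average u v) + n < v
  average-far n {u} {v} p = +-monoʳ-< u (≤-trans (n≤1+n _) 2+n≤half) , upper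
    where
    half = ⌊ v ∸ u /2⌋
    2+n≤half : 2 + n ≤ half
    2+n≤half = ≤-trans (≤-reflexive (n≡⌊n+n/2⌋ (2 + n)))
      (⌊n/2⌋-mono (≤-trans (≤-reflexive (sym (m+n∸m≡n u _))) (∸-monoˡ-≤ u (<⇒≤ p))))
    open ≤-Reasoning
    upper : suc (average u v) + n < v
    upper = begin
      suc (suc (u + half + n))     ≡⟨ trans (+-suc (u + half) (suc n)) (cong suc (+-suc (u + half) n)) ⟨
      u + half + (2 + n)           ≤⟨ +-monoʳ-≤ (u + half) (≤-trans 2+n≤half (⌊n/2⌋≤⌈n/2⌉ (v ∸ u))) ⟩
      u + half + ⌈ v ∸ u /2⌉       ≡⟨ +-assoc u half ⌈ v ∸ u /2⌉ ⟩
      u + (half + ⌈ v ∸ u /2⌉)     ≡⟨ cong (u +_) (⌊n/2⌋+⌈n/2⌉≡n (v ∸ u)) ⟩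
      u + (v ∸ u)                  ≡⟨ m+[n∸m]≡n (≤-trans (m≤m+n u _) (<⇒≤ p)) ⟩
      v                            ∎

  ≪-dense : ∀ a b → a ≪ b → ∃ λ c → a ≪ c × c ≪ b
  ≪-dense a b a≪b = c
      , far⇒≪ {a} {c} (λ n → zipWithᵃ (λ x p r → <-≤-trans (proj₁ p) (RoundsUp-≥ r)) (bounds n) (proj₂ c-up))
      , far⇒≪ {c} {b} (λ n → zipWithᵃ (λ x p r → ≤-<-trans (+-monoˡ-≤ n (RoundsUp-≤ r)) (proj₂ p)) (bounds n) (proj₂ c-up))
    where
    c-up = up (lift₂ {F = average} (v0 +c half-c (v1 ∸c v0)) (val-c a) (val-c b))
    c = proj₁ c-up
    bounds : ∀ n → Almost λ x → val a x + n < average (val a x) (val b x) ×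
                                suc (average (val a x) (val b x)) + n < val b x
    bounds n = mapᵃ (λ x → average-far n) (≪⇒far {a} {b} a≪b ((2 + n) + (2 + n)))

  index : Elem → ℕ
  index (e , _) = ⌜ e ⌝

  -- Elements also carry proofs, so equal indices give equal values rather than equal elements.
  index-≈ : ∀ a b → index a ≡ index b → a ≈ b
  index-≈ a b eq = ≈-pointwise a b (zipWithᵃ (λ { x (y , p , va) (z , q , vb) →
    trans va (trans (cong key (⌜⌝-functional eq p q)) (sym vb)) }) (⇓-val a) (⇓-val b))

  -- Equal positions give back equal values because `key` is injective on the domain.
  =C⇔≈ : ∀ a b → a =C b ⇔ a ≈ b
  =C⇔≈ a b = mk⇔
    (λ eq → ≈-pointwise a b (mapᵃ (λ { x (y , p , q) → trans (val-⇓ a p) (sym (val-⇓ b q)) }) eq))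
    (λ a≈b → mapᵃ (λ { x (eq , (y , p , va) , (z , q , vb)) → y , p , subst (proj₁ b ⟨ x ⟩⇓_)
        (key-injective (to (dom⇔ z) (proj₂ (proj₂ b) x z q)) (to (dom⇔ y) (proj₂ (proj₂ a) x y p))
          (trans (sym vb) (trans (sym eq) va))) q })
      (pointwise-≈ a b a≈b ∩ ⇓-val a ∩ ⇓-val b))

  ≺C⇔≺ : ∀ a b → a ≺C b ⇔ a ≺ b
  ≺C⇔≺ a b = mk⇔
    (mapᵃ λ { x (y , z , p , q , y≺z) → subst₂ _<_ (sym (val-⇓ a p)) (sym (val-⇓ b q)) (to (ord⇔ y z) y≺z) })
    (λ a<b → mapᵃ (λ { x (lt , (y , p , va) , (z , q , vb)) → y , z , p , q ,
                    from (ord⇔ y z) (subst₂ _<_ va vb lt) })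
      (a<b ∩ ⇓-val a ∩ ⇓-val b))

  typeωζη : HasTypeωζη 𝓛 C
  typeωζη = toωζη
    , (λ a b p → toωζη-cong {a} {b} (to (=C⇔≈ a b) p))
    , (λ a b p → from (=C⇔≈ a b) (toωζη-injective p))
    , (λ a b → mk⇔ (λ p → toωζη-mono {a} {b} (to (≺C⇔≺ a b) p)) (λ p → from (≺C⇔≺ a b) (toωζη-cancel p)))
    , toωζη-onto
    where open OmegaZetaEtaType lem discrete index index-≈ ≪-dense ≪-above

theorem4p8 : ExcludedMiddle 0ℓ →
    Σ ComputableLinearOrder λ 𝓛 →
    HasTypeω 𝓛 × ¬ ComputablyIsoℕ 𝓛 ×
    (∀ (C : Pred) → Cohesive C → HasTypeωζη 𝓛 C)
theorem4p8 lem = 𝓛 , Rank.typeω lem , not-computably-ω , λ C C-cohesive → Power.typeωζη lem C C-cohesive
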